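{- For every $n\ge 1$, the set $\mathcal A_n$ of self-complementary (equivalently, achiral) rotation classes of noncrossing partitions of $[n]$ is equinumerous with the set of self-complementary noncrossing partitions of $[n]$, and hence $|\mathcal A_n|=\binom{n}{\lfloor n/2\rfloor}$.
   Context: Write $[n]=\{1,2,\dots,n\}$. A partition of $[n]$ is noncrossing if no quadruple $a<b<c<d$ has $a,c$ in one block and $b,d$ in a different block. The rotation operator $R$ on partitions of $[n]$ is induced by the map $i\mapsto i+1\pmod n$ on $[n]$. The rotation class of $\pi$ is $A(\pi)=\{R^i(\pi): i\ge 1\}$. The complement $C(\pi)$ of a partition $\pi$ of $[n]$ is obtained by replacing every element $i$ by $n+1-i$. Both $R$ and $C$ preserve the noncrossing property, and $C\circ R=R^{ -1}\circ C$, so $C$ permutes rotation classes. A partition $\pi$ is self-complementary if $C(\pi)=\pi$; a rotation class $A$ is self-complementary (also called achiral) if $C(A)=A$ as a set of partitions. A self-complementary rotation class need not contain any self-complementary partition. -}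

module Defs where

open import Data.Fin.Base using (Fin; toℕ; _<_)
open import Data.Fin.Permutation using (Permutation′; permutation; reverse; _⟨$⟩ˡ_)
open import Data.Fin.Properties using (toℕ-injective; toℕ-fromℕ<; toℕ<n)
open import Data.Nat.Base using (ℕ; pred; _+_; _%_; _≥_; NonZero)
open import Data.Nat.DivMod using (_mod_; m%n<n; m<n⇒m%n≡m; %-distribˡ-+; m%n%n≡m%n; [m+n]%n≡m%n)
open import Data.Nat.GeneralisedArithmetic using (iterate)
open import Data.Nat.Properties using (+-assoc; +-comm; suc-pred)
open import Data.Product.Base using (∃-syntax; _×_; _,_)
open import Function.Base using (_on_)
open import Function.Bundles using (_⇔_)
import Function.Properties.Equivalence as ⇔
open import Level using (0ℓ; suc)
open import Relation.Binary.Bundles using (Setoid)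
import Relation.Binary.Construct.On as On
open import Relation.Binary.Core using (Rel)
open import Relation.Binary.PropositionalEquality.Core using (_≡_; cong; sym; trans)
open import Relation.Binary.PropositionalEquality.Properties using (module ≡-Reasoning)
open import Relation.Binary.Structures using (IsDecEquivalence)
open import Relation.Nullary.Negation.Core using (¬_)
open import Relation.Unary using (Pred; _∈_; _≐_)
open import Relation.Unary.Relation.Binary.Equality using (≐-setoid)

-- The element i ∈ {1,…,n} is represented by the element of Fin n with value i − 1.
-- A partition is given by the relation "lies in the same block as"; as the
-- ground set is finite, this relation is taken to be decidable.

record Partition (n : ℕ) : Set₁ where
  field
    _~_              : Rel (Fin n) 0ℓ
    isDecEquivalence : IsDecEquivalence _~_

open Partition using (isDecEquivalence)

SameBlock : ∀ {n} → Partition n → Rel (Fin n) 0ℓ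
SameBlock = Partition._~_

infix 4 _≈_

_≈_ : ∀ {n} → Rel (Partition n) 0ℓ
π ≈ ρ = ∀ i j → SameBlock π i j ⇔ SameBlock ρ i j

partitionSetoid : ℕ → Setoid (suc 0ℓ) 0ℓ
partitionSetoid n = record
  { Carrier       = Partition n
  ; _≈_           = _≈_
  ; isEquivalence = record
    { refl  = λ i j → ⇔.refl
    ; sym   = λ p i j → ⇔.sym (p i j)
    ; trans = λ p q i j → ⇔.trans (p i j) (q i j)
    }
  }

NonCrossing : ∀ {n} → Pred (Partition n) 0ℓ
NonCrossing {n} π = ∀ (a b c d : Fin n) → a < b → b < c → c < d →
                    ¬ (a ~ c × b ~ d × ¬ (a ~ b))
  where open Partition π

-- The partition whose blocks are the images σ(B) of the blocks B of π:
-- i and j share a block iff σ⁻¹(i) and σ⁻¹(j) share a block of π.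

image : ∀ {n} → Permutation′ n → Partition n → Partition n
image σ π = record
  { _~_              = SameBlock π on (σ ⟨$⟩ˡ_)
  ; isDecEquivalence = On.isDecEquivalence (σ ⟨$⟩ˡ_) (isDecEquivalence π)
  }

private
  shift : ∀ {n} .{{_ : NonZero n}} → ℕ → Fin n → Fin n
  shift {n} k i = (toℕ i + k) mod n

  shift-shift : ∀ {n} .{{_ : NonZero n}} j k → j + k ≡ n →
                (i : Fin n) → shift k (shift j i) ≡ i
  shift-shift {n} j k j+k≡n i = toℕ-injective (begin
    toℕ (shift k (shift j i))              ≡⟨ toℕ-fromℕ< (m%n<n _ n) ⟩
    (toℕ (shift j i) + k) % n              ≡⟨ cong (λ x → (x + k) % n) (toℕ-fromℕ< (m%n<n _ n)) ⟩
    ((toℕ i + j) % n + k) % n              ≡⟨ %-distribˡ-+ ((toℕ i + j) % n) k n ⟩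
    ((toℕ i + j) % n % n + k % n) % n      ≡⟨ cong (λ x → (x + k % n) % n) (m%n%n≡m%n (toℕ i + j) n) ⟩
    ((toℕ i + j) % n + k % n) % n          ≡⟨ %-distribˡ-+ (toℕ i + j) k n ⟨
    (toℕ i + j + k) % n                    ≡⟨ cong (_% n) (+-assoc (toℕ i) j k) ⟩
    (toℕ i + (j + k)) % n                  ≡⟨ cong (λ x → (toℕ i + x) % n) j+k≡n ⟩
    (toℕ i + n) % n                        ≡⟨ [m+n]%n≡m%n (toℕ i) n ⟩
    toℕ i % n                              ≡⟨ m<n⇒m%n≡m (toℕ<n i) ⟩
    toℕ i                                  ∎)
    where open ≡-Reasoning

rotation : ∀ n .{{_ : NonZero n}} → Permutation′ n
rotation n = permutation
  (λ i → (toℕ i + 1) mod n)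
  (λ i → (toℕ i + pred n) mod n)
  (shift-shift (pred n) 1 (trans (+-comm (pred n) 1) (suc-pred n)))
  (shift-shift 1 (pred n) (suc-pred n))

R : ∀ {n} .{{_ : NonZero n}} → Partition n → Partition n
R {n} = image (rotation n)

C : ∀ {n} → Partition n → Partition n
C = image reverse

-- A π is the set { Rⁱ(π) : i ≥ 1 }.

A : ∀ {n} .{{_ : NonZero n}} → Partition n → Pred (Partition n) 0ℓ
A π ρ = ∃[ i ] i ≥ 1 × iterate R π i ≈ ρ

-- The set { C(π) : π ∈ 𝒜 }.

C[_] : ∀ {n} → Pred (Partition n) 0ℓ → Pred (Partition n) (suc 0ℓ)
C[ 𝒜 ] ρ = ∃[ π ] π ∈ 𝒜 × C π ≈ ρ

record SelfComplementaryNC (n : ℕ) : Set₁ where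
  field
    partition         : Partition n
    nonCrossing       : NonCrossing partition
    selfComplementary : C partition ≈ partition

record SelfComplementaryClass (n : ℕ) .{{_ : NonZero n}} : Set₁ where
  field
    members           : Pred (Partition n) 0ℓ
    isRotationClass   : ∃[ π ] NonCrossing π × members ≐ A π
    selfComplementary : C[ members ] ≐ members

-- Elements of the following two setoids are compared only as partitions and as
-- sets of partitions respectively; in particular the representative π chosen
-- in isRotationClass is irrelevant.

selfComplementaryNCs : ℕ → Setoid (suc 0ℓ) 0ℓ
selfComplementaryNCs n = On.setoid (partitionSetoid n) (SelfComplementaryNC.partition {n})

selfComplementaryClasses : ∀ n .{{_ : NonZero n}} → Setoid (suc 0ℓ) (suc 0ℓ)
selfComplementaryClasses n = On.setoid (≐-setoid (Partition n) 0ℓ) (SelfComplementaryClass.members {n})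

{-# OPTIONS --safe #-}

-- The Kreweras complement K satisfies K² = R and C K C = K⁻¹ on noncrossing
-- partitions, so K and C generate a dihedral action in which the rotation classes
-- are the orbits of K².  If C(π) = K^(2k)(π), then K^k(π) is fixed by C; hence the
-- K-orbits meeting an achiral class are those containing self-complementary
-- partitions.  A K-orbit of odd size contains exactly one self-complementary
-- partition and is one rotation class; one of even size contains exactly two and
-- splits into two rotation classes.  Matching them up orbit by orbit yields the
-- first bijection.
--
-- Reading for each element whether it is the first and whether it is the last of
-- its block turns a noncrossing partition of [n] into a Dyck path of length 2n,
-- which is symmetric iff the partition is self-complementary.  So the latter
-- correspond to nonnegative paths of length n, and there are n C ⌊n/2⌋ of these.

module Submission where

open import Defs using (selfComplementaryNCs; selfComplementaryClasses)
open import Data.Fin.Base using (Fin)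
open import Data.Nat.Base using (ℕ; NonZero; ⌊_/2⌋)
open import Data.Nat.Combinatorics using (_C_)
open import Data.Product.Base using (_×_)
open import Function.Bundles using (Bijection)
open import Relation.Binary.PropositionalEquality using (setoid)

open import Defs using (Partition; SameBlock; _≈_; partitionSetoid; NonCrossing; rotation; R; A; SelfComplementaryNC; SelfComplementaryClass) renaming (C to 𝐂)
open import Data.Bool.Base using (Bool; true; false; not; _xor_; b≤b; f≤t) renaming (_≤_ to _≤ᵇ_)
open import Data.Bool.Properties using (T-≡; not-involutive; not-injective; xor-annihilates-not; xor-same; xor-inverseˡ; xor-inverseʳ) renaming (_≟_ to _≟ᵇ_)
open import Data.Empty using (⊥-elim)
open import Data.Fin.Base as Fin using (toℕ; fromℕ<; join; opposite; splitAt)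
open import Data.Fin.Permutation using (_⟨$⟩ˡ_; _⟨$⟩ʳ_; inverseˡ)
open import Data.Fin.Properties using (any?; all?; join-splitAt; opposite-involutive; opposite-prop; splitAt-join; toℕ-fromℕ<; toℕ-inject; toℕ-injective; toℕ<n; ¬∀⟶∃¬-smallest)
open import Data.Nat.Base using (zero; suc; pred; _+_; _*_; _∸_; _⊓_; _⊔_; _/_; _%_; _≤_; _<_; _<ᵇ_; z≤n; s≤s; >-nonZero; >-nonZero⁻¹)
open import Data.Nat.Combinatorics using (k>n⇒nCk≡0; nCk+nC[k+1]≡[n+1]C[k+1]; nCk≡nC[n∸k]; nCn≡1)
open import Data.Nat.DivMod using (%-distribˡ-+; [m+kn]%n≡m%n; [m+n]%n≡m%n; m%n%n≡m%n; m%n<n; m<n⇒m%n≡m; m≡m%n+[m/n]*n)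
open import Data.Nat.Divisibility using (_∣_; _∣?_; >⇒∤; divides; m%n≡0⇒n∣m)
open import Data.Nat.GeneralisedArithmetic using (fold; iterate)
import Data.Nat.Properties as ℕ
open import Data.Nat.Tactic.RingSolver using (solve-∀)
open import Data.Product.Base using (∃-syntax; _,_; proj₁; proj₂)
open import Data.Sum.Base using (_⊎_; inj₁; inj₂)
open import Function.Base using (_∘_; flip)
open import Function.Bundles using (Equivalence; Inverse; _↔_; _⇔_; mk↔ₛ′; mk⇔)
open import Function.Properties.Bijection using (Bijection⇒Inverse)
open import Level using () renaming (_⊔_ to _⊔ˡ_)
import Function.Construct.Composition as Composition
import Function.Construct.Symmetry as Symmetry
open import Function.Properties.Inverse using (Inverse⇒Bijection)
open import Relation.Binary.Bundles using (Setoid)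
open import Relation.Binary.Core using (Rel)
open import Relation.Binary.Definitions using (tri<; tri≈; tri>) renaming (Decidable to Decidable₂)
open import Relation.Binary.PropositionalEquality using (_≡_; _≢_; refl; sym; trans; cong; cong₂; subst; subst₂; module ≡-Reasoning)
open import Relation.Binary.Structures using (IsDecEquivalence)
open import Relation.Nullary.Decidable using (Dec; yes; no; does; dec-false; dec-true; decidable-stable; does-⇔; map′; ¬?; _→-dec_; _×-dec_; _⊎-dec_)
open import Relation.Nullary.Negation.Core using (¬_; contradiction)
open import Relation.Unary using (Decidable; Pred; _≐_)
open import Relation.Unary.Properties using (≐-sym; ≐-trans)

open Equivalence using (to; from)

-- An even `K`-orbit admits no canonical matching. Its two self-complementary partitions are half an
-- orbit apart, so when half the orbit size is even they lie in the same rotation class and the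
-- other class contains none. Sending a partition to its own class would therefore fail: one of the
-- two must go to the class of a neighbour under `K`. Which of them stays has to depend on the orbit
-- alone, so the orbit needs a distinguished fixpoint; it is the one of least number in an
-- enumeration of all fixpoints. For this reason the lattice path count precedes the matching and is
-- used in it.
--
-- `K² = R` has the following source. `K π` and `K⁺ π` are the same partition of the cuts between
-- cyclically consecutive elements, with a cut named after the element following it or the one
-- preceding it. The two names differ by one rotation, so `R (K⁺ π)` is `K π`; and `K⁺` undoes `K`
-- on noncrossing partitions.

private
  variable
    n : ℕ

module Part {n} (π : Partition n) where
  open Partition π public
  open IsDecEquivalence isDecEquivalence public
    using () renaming (refl to ~-refl; sym to ~-sym; trans to ~-trans; _≟_ to _~?_)

module ≈ {n} = Setoid (partitionSetoid n)

least : ∀ {p} {P : Pred (Fin n) p} → Decidable P → ∃[ i ] P i → ∃[ i ] P i × (∀ j → P j → i Fin.≤ j)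
least {n} {P = P} P? (w , Pw) with ¬∀⟶∃¬-smallest n (¬_ ∘ P) (¬? ∘ P?) (λ ∀¬P → ∀¬P w Pw)
... | i , ¬¬Pi , below = i , decidable-stable (P? i) ¬¬Pi , λ j Pj → ℕ.≮⇒≥ λ j<i →
  below (fromℕ< j<i) (subst P (toℕ-injective (sym (trans (toℕ-inject _) (toℕ-fromℕ< j<i)))) Pj)

opposite-mono-< : {i j : Fin n} → i Fin.< j → opposite j Fin.< opposite i
opposite-mono-< {i = i} {j} i<j = subst₂ _<_ (sym (opposite-prop j)) (sym (opposite-prop i))
  (ℕ.∸-monoʳ-< (s≤s i<j) (toℕ<n j))

opposite-mono-≤ : {i j : Fin n} → i Fin.≤ j → opposite j Fin.≤ opposite i
opposite-mono-≤ {n} {i} {j} i≤j = subst₂ _≤_ (sym (opposite-prop j)) (sym (opposite-prop i))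
  (ℕ.∸-monoʳ-≤ n (s≤s i≤j))

greatest : ∀ {p} {P : Pred (Fin n) p} → Decidable P → ∃[ i ] P i → ∃[ i ] P i × (∀ j → P j → j Fin.≤ i)
greatest {n} {P = P} P? (w , Pw)
  with least {P = P ∘ opposite} (P? ∘ opposite) (opposite w , subst P (sym (opposite-involutive w)) Pw)
... | i , Pi , below = opposite i , Pi , λ j Pj → ℕ.≮⇒≥ λ oi<j →
  ℕ.<⇒≱ (subst (opposite j Fin.<_) (opposite-involutive i) (opposite-mono-< oi<j))
    (below (opposite j) (subst P (sym (opposite-involutive j)) Pj))

-- The Kreweras complement as a duality between elements and cuts.

lt : Fin n → Fin n → Bool
lt i j = toℕ i <ᵇ toℕ j

xor-swap : ∀ w x y z → w xor x ≡ y xor z → w xor y ≡ x xor z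
xor-swap false x false z refl = sym (xor-same x)
xor-swap false x true  z refl = sym (xor-inverseˡ z)
xor-swap true  x false z refl = sym (xor-inverseʳ x)
xor-swap true  x true  z eq   = trans (sym (xor-same x)) (cong (x xor_) (not-injective eq))

-- Partitions of cut points: two cuts are equivalent when no pair of related
-- elements lies on different sides of exactly one of them.  For φ = flip lt the
-- cuts are placed just before the elements, for φ = lt just after them.

dual : (Fin n → Fin n → Bool) → Partition n → Partition n
dual φ π = record
  { _~_              = λ i j → ∀ a b → a ~ b → φ i a xor φ i b ≡ φ j a xor φ j b
  ; isDecEquivalence = record
    { isEquivalence = record
      { refl  = λ a b _ → refl
      ; sym   = λ p a b r → sym (p a b r)
      ; trans = λ p q a b r → trans (p a b r) (q a b r)
      }
    ; _≟_ = λ i j → all? λ a → all? λ b → (a ~? b) →-dec (_ ≟ᵇ _)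
    }
  }
  where open Part π

K K⁺ : Partition n → Partition n
K  = dual (flip lt)
K⁺ = dual lt

dual-cong : ∀ φ {π ρ : Partition n} → π ≈ ρ → dual φ π ≈ dual φ ρ
dual-cong φ π≈ρ i j = mk⇔ (λ p a b r → p a b (from (π≈ρ a b) r)) (λ p a b r → p a b (to (π≈ρ a b) r))

-- The unit of a Galois connection: that two cuts separate two elements is a condition symmetric in
-- both pairs, because `xor-swap` moves terms across an equation in characteristic two.
self-dual : ∀ φ (π : Partition n) i j → SameBlock π i j → SameBlock (dual φ (dual (flip φ) π)) i j
self-dual φ π i j i~j c d c~d = xor-swap (φ i c) (φ j c) (φ i d) (φ j d) (c~d i j i~j)

lt-true : {i j : Fin n} → i Fin.< j → lt i j ≡ true
lt-true i<j = to T-≡ (ℕ.<⇒<ᵇ i<j)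

lt-false : {i j : Fin n} → j Fin.≤ i → lt i j ≡ false
lt-false {i = i} {j} j≤i with lt i j in eq
... | false = refl
... | true  = contradiction (ℕ.<ᵇ⇒< _ _ (from T-≡ eq)) (ℕ.≤⇒≯ j≤i)

lt-monoʳ : ∀ a {i j : Fin n} → i Fin.≤ j → lt a i ≤ᵇ lt a j
lt-monoʳ a {i} {j} i≤j with lt a i in eq
... | true  = subst (true ≤ᵇ_) (sym (lt-true (ℕ.<-≤-trans (ℕ.<ᵇ⇒< _ _ (from T-≡ eq)) i≤j))) b≤b
... | false with lt a j
...   | true  = f≤t
...   | false = b≤b

-- Of two increasing sequences that start with different values, one is true throughout; as they
-- also end differently, the other is false throughout.
xor-convex : ∀ {a b c a′ b′ c′} → a ≤ᵇ b → b ≤ᵇ c → a′ ≤ᵇ b′ → b′ ≤ᵇ c′ →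
             a xor a′ ≡ true → c xor c′ ≡ true → b xor b′ ≡ true
xor-convex {true}  b≤b b≤b b≤b b≤b p _ = p
xor-convex {false} {a′ = true} b≤b b≤b b≤b b≤b p _ = p

separates-convex : ∀ (a b : Fin n) {i j k : Fin n} → i Fin.≤ j → j Fin.≤ k →
                   lt a i xor lt b i ≡ true → lt a k xor lt b k ≡ true → lt a j xor lt b j ≡ true
separates-convex a b i≤j j≤k =
  xor-convex (lt-monoʳ a i≤j) (lt-monoʳ a j≤k) (lt-monoʳ b i≤j) (lt-monoʳ b j≤k)

-- The cuts separating two elements form an interval. A related pair separated at `a` is separated
-- at `c`, hence at `b` in between; one separated at `b` is separated at `d`, hence at `c`, hence at
-- `a`.
K-nonCrossing : (π : Partition n) → NonCrossing (K π)
K-nonCrossing π a b c d a<b b<c c<d (a~c , b~d , a≁b) = a≁b λ p q p~q → agree p q (a~c p q p~q) (b~d p q p~q)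
  where
  agree : ∀ p q → lt p a xor lt q a ≡ lt p c xor lt q c → lt p b xor lt q b ≡ lt p d xor lt q d →
          lt p a xor lt q a ≡ lt p b xor lt q b
  agree p q ac bd with lt p a xor lt q a in ea | lt p b xor lt q b in eb
  ... | true  | true  = refl
  ... | false | false = refl
  ... | true  | false = trans (sym (separates-convex p q (ℕ.<⇒≤ a<b) (ℕ.<⇒≤ b<c) ea (sym ac))) eb
  ... | false | true  = trans ac (separates-convex p q (ℕ.<⇒≤ b<c) (ℕ.<⇒≤ c<d) eb (sym bd))

lt-opposite : (i j : Fin n) → lt (opposite i) (opposite j) ≡ lt j i
lt-opposite i j with toℕ j ℕ.<? toℕ i
... | yes j<i = trans (lt-true (opposite-mono-< j<i)) (sym (lt-true j<i))
... | no  j≮i = trans (lt-false (opposite-mono-≤ (ℕ.≮⇒≥ j≮i))) (sym (lt-false (ℕ.≮⇒≥ j≮i)))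

𝐂-cong : {π ρ : Partition n} → π ≈ ρ → 𝐂 π ≈ 𝐂 ρ
𝐂-cong π≈ρ i j = π≈ρ (opposite i) (opposite j)

𝐂-involutive : (π : Partition n) → 𝐂 (𝐂 π) ≈ π
𝐂-involutive π i j rewrite opposite-involutive i | opposite-involutive j = mk⇔ (λ p → p) (λ p → p)

-- Reversing the order turns the cut before an element into the cut after its mirror image.
𝐂-K : (π : Partition n) → 𝐂 (K π) ≈ K⁺ (𝐂 π)
𝐂-K {n} π i j = mk⇔
  (λ p a b r → subst₂ _≡_ (flips a b i) (flips a b j) (p (opposite a) (opposite b) r))
  (λ p a b r → subst₂ _≡_ (flips′ a b i) (flips′ a b j)
     (p (opposite a) (opposite b) (subst₂ (SameBlock π) (sym (opposite-involutive a)) (sym (opposite-involutive b)) r)))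
  where
  flips : ∀ a b i → lt (opposite a) (opposite i) xor lt (opposite b) (opposite i) ≡ lt i a xor lt i b
  flips a b i = cong₂ _xor_ (lt-opposite a i) (lt-opposite b i)
  flips′ : ∀ a b i → lt i (opposite a) xor lt i (opposite b) ≡ lt a (opposite i) xor lt b (opposite i)
  flips′ a b i = trans (sym (flips (opposite a) (opposite b) i))
    (cong₂ (λ x y → lt x (opposite i) xor lt y (opposite i)) (opposite-involutive a) (opposite-involutive b))

-- Rotation, and `K⁺` as inverse of `K` on noncrossing partitions.

module _ {n} .{{_ : NonZero n}} where

  previous : Fin n → Fin n
  previous = rotation n ⟨$⟩ˡ_

  toℕ-previous : ∀ i → toℕ (previous i) ≡ (toℕ i + pred n) % n
  toℕ-previous i = toℕ-fromℕ< (m%n<n _ n)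

  toℕ-previous-zero : ∀ i → toℕ i ≡ 0 → toℕ (previous i) ≡ pred n
  toℕ-previous-zero i i≡0 = begin
    toℕ (previous i)       ≡⟨ toℕ-previous i ⟩
    (toℕ i + pred n) % n   ≡⟨ cong (λ x → (x + pred n) % n) i≡0 ⟩
    pred n % n             ≡⟨ m<n⇒m%n≡m (ℕ.≤-reflexive (ℕ.suc-pred n)) ⟩
    pred n                 ∎
    where open ≡-Reasoning

  toℕ-previous-suc : ∀ i {k} → toℕ i ≡ suc k → toℕ (previous i) ≡ k
  toℕ-previous-suc i {k} i≡1+k = begin
    toℕ (previous i)       ≡⟨ toℕ-previous i ⟩
    (toℕ i + pred n) % n   ≡⟨ cong (λ x → (x + pred n) % n) i≡1+k ⟩
    (suc k + pred n) % n   ≡⟨ cong (_% n) (sym (ℕ.+-suc k (pred n))) ⟩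
    (k + suc (pred n)) % n ≡⟨ cong (λ x → (k + x) % n) (ℕ.suc-pred n) ⟩
    (k + n) % n            ≡⟨ [m+n]%n≡m%n k n ⟩
    k % n                  ≡⟨ m<n⇒m%n≡m (ℕ.<-trans (ℕ.≤-reflexive (sym i≡1+k)) (toℕ<n i)) ⟩
    k                      ∎
    where open ≡-Reasoning

  -- The cuts just before i and just after the cyclic predecessor of i are the
  -- same; for i = 0 one of them has everything on one side, the other nothing.
  lt-previous : ∀ i a b → lt (previous i) a xor lt (previous i) b ≡ lt a i xor lt b i
  lt-previous i a b = by-cases (toℕ i) refl
    where
    by-cases : ∀ t → toℕ i ≡ t → lt (previous i) a xor lt (previous i) b ≡ lt a i xor lt b i
    by-cases zero i≡0 = cong₂ _xor_ (eq a) (eq b)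
      where
      eq : ∀ c → lt (previous i) c ≡ lt c i
      eq c = trans
        (lt-false (subst (toℕ c ≤_) (sym (toℕ-previous-zero i i≡0))
          (ℕ.≤-pred (subst (toℕ c <_) (sym (ℕ.suc-pred n)) (toℕ<n c)))))
        (sym (lt-false (subst (_≤ toℕ c) (sym i≡0) z≤n)))
    by-cases (suc k) i≡1+k = trans (cong₂ _xor_ (eq a) (eq b)) (xor-annihilates-not (lt a i) (lt b i))
      where
      eq : ∀ c → lt (previous i) c ≡ not (lt c i)
      eq c with toℕ c ℕ.<? toℕ i
      ... | yes c<i = trans
        (lt-false (subst (toℕ c ≤_) (sym (toℕ-previous-suc i i≡1+k)) (ℕ.≤-pred (subst (toℕ c <_) i≡1+k c<i))))
        (cong not (sym (lt-true c<i)))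
      ... | no  c≮i = trans
        (lt-true (subst (_< toℕ c) (sym (toℕ-previous-suc i i≡1+k)) (subst (_≤ toℕ c) i≡1+k (ℕ.≮⇒≥ c≮i))))
        (cong not (sym (lt-false (ℕ.≮⇒≥ c≮i))))

  -- One half of `K² = R`: it is applied to `K π`, where `K⁺ (K π)` gives back `π`.
  R-K⁺ : (π : Partition n) → R (K⁺ π) ≈ K π
  R-K⁺ π i j = mk⇔
    (λ p a b r → trans (sym (lt-previous i a b)) (trans (p a b r) (lt-previous j a b)))
    (λ p a b r → trans (lt-previous i a b) (trans (p a b r) (sym (lt-previous j a b))))

  R-cong : {π ρ : Partition n} → π ≈ ρ → R π ≈ R ρ
  R-cong π≈ρ i j = π≈ρ (previous i) (previous j)

  -- If the block of u lies in [m,M] and v does not, the chord joining the cuts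
  -- before m and after M separates u from v; it is a chord of K π since, by
  -- noncrossingness, no block leaves the hull [m,M] of the block of u.
  module Hull {π : Partition n} (nc : NonCrossing π) where
    open Part π

    hull-separates : ∀ {u v m M} → u ~ m → u ~ M → m Fin.≤ u → u Fin.≤ M →
                     (∀ a → u ~ a → m Fin.≤ a × a Fin.≤ M) → (v Fin.< m ⊎ M Fin.< v) →
                     SameBlock (K⁺ (K π)) u v → u ~ v
    hull-separates {u} {v} {m} {M} u~m u~M m≤u u≤M hull v∉ u≈v = ⊥-elim (true≢false (trans (sym out-v) (trans (sym out-u≡out-v) out-u)))
      where
      true≢false : true ≢ false
      true≢false ()

      m≤M : m Fin.≤ M
      m≤M = ℕ.≤-trans m≤u u≤M

      out : Fin n → Bool
      out a = lt a m xor lt M a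

      inside : ∀ {a} → m Fin.≤ a → a Fin.≤ M → out a ≡ false
      inside m≤a a≤M = cong₂ _xor_ (lt-false m≤a) (lt-false a≤M)

      outside : ∀ {a} → a Fin.< m ⊎ M Fin.< a → out a ≡ true
      outside (inj₁ a<m) = cong₂ _xor_ (lt-true a<m) (lt-false (ℕ.≤-trans (ℕ.<⇒≤ a<m) m≤M))
      outside (inj₂ M<a) = cong₂ _xor_ (lt-false (ℕ.<⇒≤ (ℕ.≤-<-trans m≤M M<a))) (lt-true M<a)

      position : ∀ a → (m Fin.≤ a × a Fin.≤ M) ⊎ (a Fin.< m ⊎ M Fin.< a)
      position a with toℕ a ℕ.<? toℕ m | toℕ M ℕ.<? toℕ a
      ... | yes a<m | _       = inj₂ (inj₁ a<m)
      ... | no  _   | yes M<a = inj₂ (inj₂ M<a)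
      ... | no  a≮m | no M≮a  = inj₁ (ℕ.≮⇒≥ a≮m , ℕ.≮⇒≥ M≮a)

      closed : ∀ {a b} → a ~ b → m Fin.≤ a → a Fin.≤ M → ¬ (b Fin.< m ⊎ M Fin.< b)
      closed {a} {b} a~b m≤a a≤M b∉ with u ~? a
      ... | yes u~a = contradiction (trans (sym (outside b∉)) (inside (proj₁ (hull b u~b)) (proj₂ (hull b u~b)))) true≢false
        where u~b = ~-trans u~a a~b
      ... | no  u≁a = cross b∉
        where
        m<a : m Fin.< a
        m<a = ℕ.≤∧≢⇒< m≤a λ e → u≁a (subst (u ~_) (toℕ-injective e) u~m)
        a<M : a Fin.< M
        a<M = ℕ.≤∧≢⇒< a≤M λ e → u≁a (subst (u ~_) (toℕ-injective (sym e)) u~M)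
        m~M : m ~ M
        m~M = ~-trans (~-sym u~m) u~M
        cross : ¬ (b Fin.< m ⊎ M Fin.< b)
        cross (inj₁ b<m) = nc b m a M b<m m<a a<M (~-sym a~b , m~M , λ b~m → u≁a (~-trans u~m (~-trans (~-sym b~m) (~-sym a~b))))
        cross (inj₂ M<b) = nc m a M b m<a a<M M<b (m~M , a~b , λ m~a → u≁a (~-trans u~m m~a))

      out-cong : ∀ {a b} → a ~ b → out a ≡ out b
      out-cong {a} {b} a~b with position a | position b
      ... | inj₁ (p , q) | inj₁ (r , s) = trans (inside p q) (sym (inside r s))
      ... | inj₁ (p , q) | inj₂ r       = contradiction r (closed a~b p q)
      ... | inj₂ r       | inj₁ (p , q) = contradiction r (closed (~-sym a~b) p q)
      ... | inj₂ p       | inj₂ q       = trans (outside p) (sym (outside q))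

      -- `K` names a cut by the element after it, so the cut after `M` is that of the successor of
      -- `M`; if `M` is the last element, the successor wraps around to the first one.
      next : Fin n
      next = rotation n ⟨$⟩ʳ M

      lt-next : ∀ a b → lt a next xor lt b next ≡ lt M a xor lt M b
      lt-next a b = trans (sym (lt-previous next a b))
        (cong (λ x → lt x a xor lt x b) (inverseˡ (rotation n)))

      chord : SameBlock (K π) m next
      chord a b a~b = trans (xor-swap (lt a m) (lt M a) (lt b m) (lt M b) (out-cong a~b)) (sym (lt-next a b))

      out-u≡out-v : out u ≡ out v
      out-u≡out-v = xor-swap (lt u m) (lt v m) (lt M u) (lt M v)
        (trans (xor-swap (lt u m) (lt u next) (lt v m) (lt v next) (u≈v m next chord)) (lt-next u v))

      out-u : out u ≡ false
      out-u = inside m≤u u≤M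

      out-v : out v ≡ true
      out-v = outside v∉

    separated : ∀ {u v} → (∀ a → u ~ a → a Fin.< v) ⊎ (∀ a → u ~ a → v Fin.< a) →
                SameBlock (K⁺ (K π)) u v → u ~ v
    separated {u} {v} v∉ with least (u ~?_) (u , ~-refl) | greatest (u ~?_) (u , ~-refl)
    ... | m , u~m , m≤ | M , u~M , ≤M = hull-separates u~m u~M (m≤ u ~-refl) (≤M u ~-refl) (λ a r → m≤ a r , ≤M a r) (v∉′ v∉)
      where
      v∉′ : _ → v Fin.< m ⊎ M Fin.< v
      v∉′ (inj₁ p) = inj₂ (p M u~M)
      v∉′ (inj₂ p) = inj₁ (p m u~m)

    -- Were u < v both inside the hulls of each other's blocks, these blocks would cross.
    K⁺-K-<  : ∀ {u v} → u Fin.< v → SameBlock (K⁺ (K π)) u v → u ~ v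
    K⁺-K-< {u} {v} u<v u≈v with u ~? v
    ... | yes u~v = u~v
    ... | no  u≁v with any? (λ q → (u ~? q) ×-dec (toℕ v ℕ.<? toℕ q)) | any? (λ r → (v ~? r) ×-dec (toℕ r ℕ.<? toℕ u))
    ...   | yes (q , u~q , v<q) | yes (r , v~r , r<u) =
              ⊥-elim (nc r u v q r<u u<v v<q (~-sym v~r , u~q , λ r~u → u≁v (~-sym (~-trans v~r r~u))))
    ...   | no  ∄q              | _ = separated (inj₁ λ a u~a → ℕ.≤∧≢⇒< (ℕ.≮⇒≥ λ v<a → ∄q (a , u~a , v<a))
                                         λ e → u≁v (subst (u ~_) (toℕ-injective e) u~a)) u≈v
    ...   | _                   | no ∄r = ~-sym (separated (inj₂ λ a v~a → ℕ.≤∧≢⇒< (ℕ.≮⇒≥ λ a<u → ∄r (a , v~a , a<u))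
                                         λ e → u≁v (~-sym (subst (v ~_) (toℕ-injective (sym e)) v~a))) (Part.~-sym (K⁺ (K π)) u≈v))

    K⁺-K : K⁺ (K π) ≈ π
    K⁺-K i j = mk⇔ (related i j) (self-dual lt π i j)
      where
      related : ∀ i j → SameBlock (K⁺ (K π)) i j → i ~ j
      related i j r with ℕ.<-cmp (toℕ i) (toℕ j)
      ... | tri< i<j _ _ = K⁺-K-< i<j r
      ... | tri≈ _ i≡j _ = subst (i ~_) (toℕ-injective i≡j) ~-refl
      ... | tri> _ _ j<i = ~-sym (K⁺-K-< j<i (Part.~-sym (K⁺ (K π)) {i} {j} r))

  toℕ-previous^ : ∀ m i → toℕ (fold i previous m) ≡ (toℕ i + m * pred n) % n
  toℕ-previous^ zero    i = sym (trans (cong (_% n) (ℕ.+-identityʳ (toℕ i))) (m<n⇒m%n≡m (toℕ<n i)))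
  toℕ-previous^ (suc m) i = begin
    toℕ (previous (fold i previous m))              ≡⟨ toℕ-previous (fold i previous m) ⟩
    (toℕ (fold i previous m) + pred n) % n          ≡⟨ cong (λ x → (x + pred n) % n) (toℕ-previous^ m i) ⟩
    ((toℕ i + m * pred n) % n + pred n) % n         ≡⟨ %-remove-%ˡ ⟩
    (toℕ i + m * pred n + pred n) % n               ≡⟨ cong (_% n) (ℕ.+-assoc (toℕ i) _ _) ⟩
    (toℕ i + (m * pred n + pred n)) % n             ≡⟨ cong (λ x → (toℕ i + x) % n) (ℕ.+-comm (m * pred n) (pred n)) ⟩
    (toℕ i + suc m * pred n) % n                    ∎
    where
    open ≡-Reasoning
    %-remove-%ˡ : ((toℕ i + m * pred n) % n + pred n) % n ≡ (toℕ i + m * pred n + pred n) % n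
    %-remove-%ˡ = trans (%-distribˡ-+ ((toℕ i + m * pred n) % n) (pred n) n)
      (trans (cong (λ x → (x + pred n % n) % n) (m%n%n≡m%n (toℕ i + m * pred n) n))
             (sym (%-distribˡ-+ (toℕ i + m * pred n) (pred n) n)))

  previous^n : ∀ i → fold i previous n ≡ i
  previous^n i = toℕ-injective (begin
    toℕ (fold i previous n)    ≡⟨ toℕ-previous^ n i ⟩
    (toℕ i + n * pred n) % n   ≡⟨ cong (λ x → (toℕ i + x) % n) (ℕ.*-comm n (pred n)) ⟩
    (toℕ i + pred n * n) % n   ≡⟨ [m+kn]%n≡m%n (toℕ i) (pred n) n ⟩
    toℕ i % n                  ≡⟨ m<n⇒m%n≡m (toℕ<n i) ⟩
    toℕ i                      ∎)
    where open ≡-Reasoning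

  iterate-R : ∀ m (π : Partition n) i j →
              SameBlock (iterate R π m) i j ≡ SameBlock π (fold i previous m) (fold j previous m)
  iterate-R zero    π i j = refl
  iterate-R (suc m) π i j = iterate-R m (R π) i j

  R^n : (π : Partition n) → iterate R π n ≈ π
  R^n π i j = subst (_⇔ SameBlock π i j)
    (sym (trans (iterate-R n π i j) (cong₂ (SameBlock π) (previous^n i) (previous^n j))))
    (mk⇔ (λ p → p) (λ p → p))

-- Counting lattice paths

-- Paths from height `h` that never go below 0 and end at any height: with `h = 0`, left halves of
-- symmetric Dyck paths, whose midpoint may have any height.
data Path : ℕ → ℕ → Set where
  []   : ∀ {h} → Path h 0
  up   : ∀ {h n} → Path (suc h) n → Path h (suc n)
  down : ∀ {h n} → Path h n → Path (suc h) (suc n)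

#Path : ℕ → ℕ → ℕ
#Path h       zero    = 1
#Path zero    (suc n) = #Path 1 n
#Path (suc h) (suc n) = #Path (suc (suc h)) n + #Path h n

encode : ∀ {h n} → Path h n → Fin (#Path h n)
encode                         []       = Fin.zero
encode {zero}                  (up w)   = encode w
encode {suc h} {suc n} (up w)   = join _ (#Path h n) (inj₁ (encode w))
encode {suc h} {suc n} (down w) = join (#Path (suc (suc h)) n) _ (inj₂ (encode w))

decode : ∀ h n → Fin (#Path h n) → Path h n
decode h       zero    _ = []
decode zero    (suc n) i = up (decode 1 n i)
decode (suc h) (suc n) i with splitAt (#Path (suc (suc h)) n) i
... | inj₁ j = up (decode (suc (suc h)) n j)
... | inj₂ j = down (decode h n j)

decode-encode : ∀ {h n} (w : Path h n) → decode h n (encode w) ≡ w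
decode-encode          []       = refl
decode-encode {zero}   (up w)   = cong up (decode-encode w)
decode-encode {suc h} {suc n} (up w)
  rewrite splitAt-join (#Path (suc (suc h)) n) (#Path h n) (inj₁ (encode w)) = cong up (decode-encode w)
decode-encode {suc h} {suc n} (down w)
  rewrite splitAt-join (#Path (suc (suc h)) n) (#Path h n) (inj₂ (encode w)) = cong down (decode-encode w)

encode-decode : ∀ h n (i : Fin (#Path h n)) → encode (decode h n i) ≡ i
encode-decode h       zero    Fin.zero = refl
encode-decode zero    (suc n) i = encode-decode 1 n i
encode-decode (suc h) (suc n) i with splitAt (#Path (suc (suc h)) n) i in eq
... | inj₁ j = trans (cong (λ k → join _ (#Path h n) (inj₁ k)) (encode-decode (suc (suc h)) n j))
                     (trans (cong (join _ (#Path h n)) (sym eq)) (join-splitAt (#Path (suc (suc h)) n) (#Path h n) i))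
... | inj₂ j = trans (cong (λ k → join (#Path (suc (suc h)) n) _ (inj₂ k)) (encode-decode h n j))
                     (trans (cong (join (#Path (suc (suc h)) n) _) (sym eq)) (join-splitAt (#Path (suc (suc h)) n) (#Path h n) i))

Path↔Fin : ∀ h n → Path h n ↔ Fin (#Path h n)
Path↔Fin h n = mk↔ₛ′ encode (decode h n) (encode-decode h n) decode-encode

ΣC : ℕ → ℕ → ℕ
ΣC n zero    = 0
ΣC n (suc m) = ΣC n m + n C m

nC0≡1 : ∀ n → n C 0 ≡ 1
nC0≡1 n = trans (nCk≡nC[n∸k] {0} {n} z≤n) (nCn≡1 n)

-- Pascal's rule, summed.
ΣC-suc : ∀ n m → ΣC (suc n) (suc m) ≡ ΣC n (suc m) + ΣC n m
ΣC-suc n zero    = trans (nC0≡1 (suc n)) (sym (trans (ℕ.+-identityʳ _) (nC0≡1 n)))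
ΣC-suc n (suc m) = trans
  (cong₂ _+_ (ΣC-suc n m) (sym (nCk+nC[k+1]≡[n+1]C[k+1] n m)))
  (lemma (ΣC n m) (n C m) (n C suc m))
  where
  lemma : ∀ s a b → s + a + s + (a + b) ≡ s + a + b + (s + a)
  lemma = solve-∀

ΣC-zero : ∀ m → ΣC 0 (suc m) ≡ 1
ΣC-zero zero    = nC0≡1 0
ΣC-zero (suc m) = cong₂ _+_ (ΣC-zero m) (k>n⇒nCk≡0 {0} {suc m} (s≤s z≤n))

-- Summing the recurrence, the number of paths is a sum of consecutive binomial
-- coefficients, for k from ⌊(n − h)/2⌋ to ⌊(n + h)/2⌋.
#Path-ΣC : ∀ h n → #Path h n + ΣC n ⌊ n ∸ h /2⌋ ≡ ΣC n (suc ⌊ n + h /2⌋)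
#Path-ΣC h zero rewrite ℕ.0∸n≡0 h = sym (ΣC-zero ⌊ h /2⌋)
#Path-ΣC zero (suc n) rewrite ℕ.+-identityʳ n = begin
  #Path 1 n + ΣC (suc n) m                      ≡⟨ cong (#Path 1 n +_) (split n) ⟩
  #Path 1 n + (ΣC n ⌊ n ∸ 1 /2⌋ + ΣC n m)       ≡⟨ ℕ.+-assoc (#Path 1 n) _ _ ⟨
  #Path 1 n + ΣC n ⌊ n ∸ 1 /2⌋ + ΣC n m         ≡⟨ cong (_+ ΣC n m) (#Path-ΣC 1 n) ⟩
  ΣC n (suc ⌊ n + 1 /2⌋) + ΣC n m               ≡⟨ cong (λ k → ΣC n (suc ⌊ k /2⌋) + ΣC n m) (ℕ.+-comm n 1) ⟩
  ΣC n (suc m) + ΣC n m                         ≡⟨ ΣC-suc n m ⟨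
  ΣC (suc n) (suc m)                            ∎
  where
  open ≡-Reasoning
  m = ⌊ suc n /2⌋
  split : ∀ n → ΣC (suc n) ⌊ suc n /2⌋ ≡ ΣC n ⌊ n ∸ 1 /2⌋ + ΣC n ⌊ suc n /2⌋
  split zero    = refl
  split (suc n) = trans (ΣC-suc (suc n) ⌊ n /2⌋) (ℕ.+-comm (ΣC (suc n) (suc ⌊ n /2⌋)) _)
#Path-ΣC (suc h) (suc n) = begin
  #Path (suc (suc h)) n + #Path h n + ΣC (suc n) ⌊ n ∸ h /2⌋
    ≡⟨ cong (#Path (suc (suc h)) n + #Path h n +_) (split n h) ⟩
  #Path (suc (suc h)) n + #Path h n + (ΣC n ⌊ n ∸ suc (suc h) /2⌋ + ΣC n ⌊ n ∸ h /2⌋)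
    ≡⟨ lemma (#Path (suc (suc h)) n) (#Path h n) _ _ ⟩
  (#Path (suc (suc h)) n + ΣC n ⌊ n ∸ suc (suc h) /2⌋) + (#Path h n + ΣC n ⌊ n ∸ h /2⌋)
    ≡⟨ cong₂ _+_ (#Path-ΣC (suc (suc h)) n) (#Path-ΣC h n) ⟩
  ΣC n (suc ⌊ n + suc (suc h) /2⌋) + ΣC n (suc ⌊ n + h /2⌋)
    ≡⟨ cong (λ k → ΣC n (suc ⌊ k /2⌋) + ΣC n (suc ⌊ n + h /2⌋)) (trans (ℕ.+-suc n (suc h)) (cong suc (ℕ.+-suc n h))) ⟩
  ΣC n (suc (suc ⌊ n + h /2⌋)) + ΣC n (suc ⌊ n + h /2⌋)
    ≡⟨ ΣC-suc n (suc ⌊ n + h /2⌋) ⟨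
  ΣC (suc n) (suc (suc ⌊ n + h /2⌋))
    ≡⟨ cong (λ k → ΣC (suc n) (suc ⌊ suc k /2⌋)) (ℕ.+-suc n h) ⟨
  ΣC (suc n) (suc ⌊ suc n + suc h /2⌋) ∎
  where
  open ≡-Reasoning
  lemma : ∀ a b c d → a + b + (c + d) ≡ (a + c) + (b + d)
  lemma = solve-∀
  split : ∀ n h → ΣC (suc n) ⌊ n ∸ h /2⌋ ≡ ΣC n ⌊ n ∸ suc (suc h) /2⌋ + ΣC n ⌊ n ∸ h /2⌋
  split n h = trans (halve (n ∸ h)) (cong (λ k → ΣC n ⌊ k /2⌋ + ΣC n ⌊ n ∸ h /2⌋)
    (trans (ℕ.∸-+-assoc n h 2) (cong (n ∸_) (ℕ.+-comm h 2))))
    where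
    halve : ∀ d → ΣC (suc n) ⌊ d /2⌋ ≡ ΣC n ⌊ d ∸ 2 /2⌋ + ΣC n ⌊ d /2⌋
    -- For `d` below 2 all three sums are empty, the subtraction being truncated.
    halve 0             = refl
    halve 1             = refl
    halve (suc (suc d)) = trans (ΣC-suc n ⌊ d /2⌋) (ℕ.+-comm (ΣC n (suc ⌊ d /2⌋)) _)

-- For `h = 0` the range of the sum shrinks to the single index `⌊ n /2⌋`.
#Path-zero : ∀ n → #Path 0 n ≡ n C ⌊ n /2⌋
#Path-zero n = ℕ.+-cancelʳ-≡ (ΣC n ⌊ n /2⌋) _ _ (begin
  #Path 0 n + ΣC n ⌊ n /2⌋      ≡⟨ #Path-ΣC 0 n ⟩
  ΣC n (suc ⌊ n + 0 /2⌋)        ≡⟨ cong (λ k → ΣC n (suc ⌊ k /2⌋)) (ℕ.+-identityʳ n) ⟩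
  ΣC n ⌊ n /2⌋ + n C ⌊ n /2⌋    ≡⟨ ℕ.+-comm (ΣC n ⌊ n /2⌋) _ ⟩
  n C ⌊ n /2⌋ + ΣC n ⌊ n /2⌋    ∎)
  where open ≡-Reasoning

-- Self-complementary noncrossing partitions as lattice paths

double : ℕ → ℕ
double zero    = zero
double (suc n) = suc (suc (double n))

double-mono-≤ : ∀ {m n} → m ≤ n → double m ≤ double n
double-mono-≤ z≤n       = z≤n
double-mono-≤ (s≤s m≤n) = s≤s (s≤s (double-mono-≤ m≤n))

double-cancel-< : ∀ {m n} → double m < double n → m < n
double-cancel-< {m} {n} p = ℕ.≰⇒> λ n≤m → ℕ.<⇒≱ p (double-mono-≤ n≤m)

double-∸ : ∀ m n → double m ∸ double n ≡ double (m ∸ n)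
double-∸ m       zero    = refl
double-∸ zero    (suc n) = refl
double-∸ (suc m) (suc n) = double-∸ m n

double-∸-suc : ∀ {m n} → n < m → double m ∸ suc (double n) ≡ suc (double (m ∸ suc n))
double-∸-suc {suc m} {n} (s≤s n≤m) = trans (ℕ.+-∸-assoc 1 (double-mono-≤ n≤m)) (cong suc (double-∸ m n))

n≤double-n : ∀ n → n ≤ double n
n≤double-n zero    = z≤n
n≤double-n (suc n) = s≤s (ℕ.m≤n⇒m≤1+n (n≤double-n n))

double-n∸n : ∀ n → double n ∸ n ≡ n
double-n∸n zero    = refl
double-n∸n (suc n) = trans (ℕ.+-∸-assoc 1 (n≤double-n n)) (cong suc (double-n∸n n))

data Halved : ℕ → Set where
  even : ∀ k → Halved (double k)
  odd  : ∀ k → Halved (suc (double k))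

halve : ∀ p → Halved p
halve zero    = even 0
halve (suc p) with halve p
... | even k = odd k
... | odd  k = even (suc k)

isOdd : ℕ → Bool
isOdd zero    = false
isOdd (suc n) = not (isOdd n)

isOdd-double : ∀ n → isOdd (double n) ≡ false
isOdd-double zero    = refl
isOdd-double (suc n) = trans (not-involutive _) (isOdd-double n)

-- Visibility under a path, and the partition it induces.

Between : ℕ → ℕ → ℕ → Set
Between p r q = (p ≤ r × r ≤ q) ⊎ (q ≤ r × r ≤ p)

-- Positions p and q of a lattice path with heights H see each other along a
-- horizontal line below the path.
Visible : (ℕ → ℕ) → ℕ → ℕ → Set
Visible H p q = H p ≡ H q × (∀ r → Between p r q → H p ≤ H r)

module _ (H : ℕ → ℕ) where

  visible-refl : ∀ p → Visible H p p
  visible-refl p = refl , λ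
    { r (inj₁ (p≤r , r≤p)) → ℕ.≤-reflexive (cong H (ℕ.≤-antisym p≤r r≤p))
    ; r (inj₂ (p≤r , r≤p)) → ℕ.≤-reflexive (cong H (ℕ.≤-antisym p≤r r≤p)) }

  visible-sym : ∀ {p q} → Visible H p q → Visible H q p
  visible-sym {p} {q} (e , above) = sym e , λ
    { r (inj₁ b) → subst (_≤ H r) e (above r (inj₂ b))
    ; r (inj₂ b) → subst (_≤ H r) e (above r (inj₁ b)) }

  visible-trans : ∀ {p q s} → Visible H p q → Visible H q s → Visible H p s
  visible-trans {p} {q} {s} (e , above) (e′ , above′) = trans e e′ , between
    where
    above″ : ∀ r → Between q r s → H p ≤ H r
    above″ r b = subst (_≤ H r) (sym e) (above′ r b)
    between : ∀ r → Between p r s → H p ≤ H r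
    between r (inj₁ (p≤r , r≤s)) with ℕ.≤-total r q
    ... | inj₁ r≤q = above r (inj₁ (p≤r , r≤q))
    ... | inj₂ q≤r = above″ r (inj₁ (q≤r , r≤s))
    between r (inj₂ (s≤r , r≤p)) with ℕ.≤-total r q
    ... | inj₁ r≤q = above″ r (inj₂ (s≤r , r≤q))
    ... | inj₂ q≤r = above r (inj₂ (q≤r , r≤p))

  visible? : ∀ p q → Dec (Visible H p q)
  visible? p q = (H p ℕ.≟ H q) ×-dec map′ (λ f r b → f {r} (s≤s (bound b)) b) (λ f {r} _ → f r)
    (ℕ.allUpTo? (λ r → between? r →-dec (H p ℕ.≤? H r)) (suc (p ⊔ q)))
    where
    between? : ∀ r → Dec (Between p r q)
    between? r = ((p ℕ.≤? r) ×-dec (r ℕ.≤? q)) ⊎-dec ((q ℕ.≤? r) ×-dec (r ℕ.≤? p))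
    bound : ∀ {r} → Between p r q → r ≤ p ⊔ q
    bound (inj₁ (_ , r≤q)) = ℕ.≤-trans r≤q (ℕ.m≤n⊔m p q)
    bound (inj₂ (_ , r≤p)) = ℕ.≤-trans r≤p (ℕ.m≤m⊔n p q)

visible-resp : ∀ {H H′ : ℕ → ℕ} {N p q} → (∀ {r} → r ≤ N → H r ≡ H′ r) → p ≤ N → q ≤ N → Visible H p q → Visible H′ p q
visible-resp eq p≤N q≤N (e , above) = trans (sym (eq p≤N)) (trans e (eq q≤N)) , λ
  { r b@(inj₁ (_ , r≤q)) → subst₂ _≤_ (eq p≤N) (eq (ℕ.≤-trans r≤q q≤N)) (above r b)
  ; r b@(inj₂ (_ , r≤p)) → subst₂ _≤_ (eq p≤N) (eq (ℕ.≤-trans r≤p p≤N)) (above r b) }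

-- Element i sits at position 2i + 1.
position : Fin n → ℕ
position i = suc (double (toℕ i))

position-mono : {i j : Fin n} → i Fin.≤ j → position i ≤ position j
position-mono i≤j = s≤s (double-mono-≤ i≤j)

position≤ : (i : Fin n) → position i ≤ double n
position≤ i = ℕ.≤-trans (ℕ.n≤1+n _) (double-mono-≤ (toℕ<n i))

position-opposite : (i : Fin n) → position (opposite i) ≡ double n ∸ position i
position-opposite {n} i = trans (cong (suc ∘ double) (opposite-prop i)) (sym (double-∸-suc (toℕ<n i)))

levels : (n : ℕ) → (ℕ → ℕ) → Partition n
levels n H = record
  { _~_              = λ i j → Visible H (position i) (position j)
  ; isDecEquivalence = record
    { isEquivalence = record
      { refl  = λ {i} → visible-refl H (position i)
      ; sym   = visible-sym H
      ; trans = visible-trans H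
      }
    ; _≟_ = λ i j → visible? H (position i) (position j)
    }
  }

-- As `b` lies between `a` and `c`, and `c` between `b` and `d`, the heights at `a` and `b` bound
-- each other; so the line from `a` to `c` passes through `b`.
levels-nonCrossing : ∀ H → NonCrossing (levels n H)
levels-nonCrossing H a b c d a<b b<c c<d ((Ha≡Hc , above-a) , (Hb≡Hd , above-b) , a≁b) =
  a≁b (ℕ.≤-antisym Ha≤Hb Hb≤Ha , λ
    { r (inj₁ (a≤r , r≤b)) → above-a r (inj₁ (a≤r , ℕ.≤-trans r≤b (position-mono (ℕ.<⇒≤ b<c))))
    ; r (inj₂ (b≤r , r≤a)) → contradiction (ℕ.≤-trans b≤r r≤a) (ℕ.<⇒≱ (s≤s (ℕ.≤-trans (ℕ.n≤1+n _) (double-mono-≤ a<b)))) })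
  where
  Ha≤Hb : H (position a) ≤ H (position b)
  Ha≤Hb = above-a _ (inj₁ (position-mono (ℕ.<⇒≤ a<b) , position-mono (ℕ.<⇒≤ b<c)))
  Hb≤Ha : H (position b) ≤ H (position a)
  Hb≤Ha = subst (H (position b) ≤_) (sym Ha≡Hc) (above-b _ (inj₁ (position-mono (ℕ.<⇒≤ b<c) , position-mono (ℕ.<⇒≤ c<d))))

levels-𝐂 : ∀ n H → (∀ {p} → p ≤ double n → H (double n ∸ p) ≡ H p) → 𝐂 (levels n H) ≈ levels n H
levels-𝐂 n H mirror i j = mk⇔
  (λ v → subst₂ (Visible H) (unreflect i) (unreflect j) (reflect (position≤ (opposite i)) (position≤ (opposite j)) v))
  (λ v → subst₂ (Visible H) (sym (position-opposite i)) (sym (position-opposite j)) (reflect (position≤ i) (position≤ j) v))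
  where
  flip≤ : ∀ {r q} → double n ∸ q ≤ r → q ≤ double n → double n ∸ r ≤ q
  flip≤ {r} {q} le q≤ = subst (double n ∸ r ≤_) (ℕ.m∸[m∸n]≡n q≤) (ℕ.∸-monoʳ-≤ (double n) le)
  flip≥ : ∀ {r q} → r ≤ double n ∸ q → q ≤ double n → q ≤ double n ∸ r
  flip≥ {r} {q} le q≤ = subst (_≤ double n ∸ r) (ℕ.m∸[m∸n]≡n q≤) (ℕ.∸-monoʳ-≤ (double n) le)
  reflect : ∀ {p q} → p ≤ double n → q ≤ double n → Visible H p q → Visible H (double n ∸ p) (double n ∸ q)
  reflect {p} {q} p≤ q≤ (e , above) = trans (mirror p≤) (trans e (sym (mirror q≤))) , λ
    { r (inj₁ (p′≤r , r≤q′)) → lower (ℕ.≤-trans r≤q′ (ℕ.m∸n≤m _ q)) (above _ (inj₂ (flip≥ r≤q′ q≤ , flip≤ p′≤r p≤)))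
    ; r (inj₂ (q′≤r , r≤p′)) → lower (ℕ.≤-trans r≤p′ (ℕ.m∸n≤m _ p)) (above _ (inj₁ (flip≥ r≤p′ p≤ , flip≤ q′≤r q≤))) }
    where
    lower : ∀ {r} → r ≤ double n → H p ≤ H (double n ∸ r) → H (double n ∸ p) ≤ H r
    lower r≤ = subst₂ _≤_ (sym (mirror p≤)) (mirror r≤)
  unreflect : ∀ i → double n ∸ position (opposite i) ≡ position i
  unreflect i = trans (sym (position-opposite (opposite i))) (cong position (opposite-involutive i))

-- The step word of a partition.

NotFirst : Partition n → ℕ → Set
NotFirst {n} π k = ∃[ i ] ∃[ j ] toℕ i ≡ k × toℕ j < k × SameBlock π j i

notFirst? : (π : Partition n) → ∀ k → Dec (NotFirst π k)
notFirst? π k = any? λ i → any? λ j → (toℕ i ℕ.≟ k) ×-dec (toℕ j ℕ.<? k) ×-dec Part._~?_ π j i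

interleave : (ℕ → Bool) → (ℕ → Bool) → ℕ → Bool
interleave f g zero    = f zero
interleave f g (suc p) = interleave g (f ∘ suc) p

interleave-even : ∀ f g k → interleave f g (double k) ≡ f k
interleave-even f g zero    = refl
interleave-even f g (suc k) = interleave-even (f ∘ suc) (g ∘ suc) k

interleave-odd : ∀ f g k → interleave f g (suc (double k)) ≡ g k
interleave-odd f g k = interleave-even g (f ∘ suc) k

-- The steps (true = up) around position 2k + 1: the first is up if k is the
-- first element of its block, the second if k is not the last one, which for a
-- self-complementary partition means that n − 1 − k is not the first one.
steps : Partition n → ℕ → Bool
steps {n} π = interleave (λ k → not (does (notFirst? π k))) (λ k → does (notFirst? π (n ∸ suc k)))

steps-even : (π : Partition n) → ∀ k → steps π (double k) ≡ not (does (notFirst? π k))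
steps-even π = interleave-even _ _

steps-odd : (π : Partition n) → ∀ k → steps π (suc (double k)) ≡ does (notFirst? π (n ∸ suc k))
steps-odd {n} π = interleave-odd (λ k → not (does (notFirst? π k))) _

steps-cong : {π ρ : Partition n} → π ≈ ρ → ∀ p → steps π p ≡ steps ρ p
steps-cong {n} {π} {ρ} π≈ρ p = by-parity (halve p)
  where
  flag : ∀ k → does (notFirst? π k) ≡ does (notFirst? ρ k)
  flag k = does-⇔ (mk⇔ (λ (i , j , e , l , r) → i , j , e , l , to (π≈ρ j i) r)
                        (λ (i , j , e , l , r) → i , j , e , l , from (π≈ρ j i) r)) (notFirst? π k) (notFirst? ρ k)
  by-parity : ∀ {p} → Halved p → steps π p ≡ steps ρ p
  by-parity (even k) = trans (steps-even π k) (trans (cong not (flag k)) (sym (steps-even ρ k)))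
  by-parity (odd k)  = trans (steps-odd π k) (trans (flag (n ∸ suc k)) (sym (steps-odd ρ k)))

letter : ∀ {h n} → Path h n → ℕ → Bool
letter []       _       = true
letter (up w)   zero    = true
letter (down w) zero    = false
letter (up w)   (suc p) = letter w p
letter (down w) (suc p) = letter w p

height : ∀ {h n} → Path h n → ℕ → ℕ
height {h} _        zero    = h
height {h} []       (suc p) = h
height     (up w)   (suc p) = height w p
height     (down w) (suc p) = height w p

Up Down : (ℕ → ℕ) → ℕ → Set
Up   H p = H (suc p) ≡ suc (H p)
Down H p = H p ≡ suc (H (suc p))

height-up : ∀ {h n} (w : Path h n) {p} → p < n → letter w p ≡ true → Up (height w) p
height-up (up w) {zero} _ _ = refl
height-up (up w)   {suc p} (s≤s p<n) = height-up w p<n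
height-up (down w) {suc p} (s≤s p<n) = height-up w p<n

height-down : ∀ {h n} (w : Path h n) {p} → p < n → letter w p ≡ false → Down (height w) p
height-down (down w) {zero} _ _ = refl
height-down (up w)   {suc p} (s≤s p<n) = height-down w p<n
height-down (down w) {suc p} (s≤s p<n) = height-down w p<n

-- Recovering a path from the partition that it induces.

mirrored : ℕ → (ℕ → ℕ) → ℕ → ℕ
mirrored n H p = H (p ⊓ (double n ∸ p))

module _ (n : ℕ) (H : ℕ → ℕ) where

  mirrored-mirror : ∀ {p} → p ≤ double n → mirrored n H (double n ∸ p) ≡ mirrored n H p
  mirrored-mirror {p} p≤ = cong H (trans (cong ((double n ∸ p) ⊓_) (ℕ.m∸[m∸n]≡n p≤)) (ℕ.⊓-comm (double n ∸ p) p))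

  mirrored-≤ : ∀ {p} → p ≤ n → mirrored n H p ≡ H p
  mirrored-≤ {p} p≤n = cong H (ℕ.m≤n⇒m⊓n≡m (ℕ.≤-trans p≤n (subst (_≤ double n ∸ p) (double-n∸n n) (ℕ.∸-monoʳ-≤ (double n) p≤n))))

module _ {n : ℕ} (w : Path 0 n) where

  private
    H : ℕ → ℕ
    H = mirrored n (height w)

    π : Partition n
    π = levels n H

  profile-up : ∀ {p} → p < n → letter w p ≡ true → Up H p
  profile-up p<n l = trans (mirrored-≤ n (height w) p<n) (trans (height-up w p<n l) (cong suc (sym (mirrored-≤ n (height w) (ℕ.<⇒≤ p<n)))))

  profile-down : ∀ {p} → p < n → letter w p ≡ false → Down H p
  profile-down p<n l = trans (mirrored-≤ n (height w) (ℕ.<⇒≤ p<n)) (trans (height-down w p<n l) (cong suc (sym (mirrored-≤ n (height w) p<n))))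

  -- The step from `q` is the step from `p` traversed backwards.
  profile-mirror : ∀ {p q} → p < double n → double n ∸ p ≡ suc q → H q ≡ H (suc p) × H (suc q) ≡ H p
  profile-mirror {p} {q} p<2n e =
    trans (cong H (ℕ.suc-injective (trans (sym e) (ℕ.+-∸-assoc 1 p<2n)))) (mirrored-mirror n (height w) p<2n) ,
    trans (cong H (sym e)) (mirrored-mirror n (height w) (ℕ.<⇒≤ p<2n))

  step-left : ∀ {p} → p < n → Up H p ⊎ Down H p
  step-left {p} p<n with letter w p in l
  ... | true  = inj₁ (profile-up p<n l)
  ... | false = inj₂ (profile-down p<n l)

  profile-step : ∀ {p} → p < double n → Up H p ⊎ Down H p
  profile-step {p} p<2n with p ℕ.<? n
  ... | yes p<n = step-left p<n
  ... | no  p≮n = via (double n ∸ p) refl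
    where
    via : ∀ d → double n ∸ p ≡ d → Up H p ⊎ Down H p
    via zero    e = contradiction (ℕ.m∸n≡0⇒m≤n e) (ℕ.<⇒≱ p<2n)
    via (suc q) e with profile-mirror p<2n e | step-left (subst₂ _≤_ e (double-n∸n n) (ℕ.∸-monoʳ-≤ (double n) (ℕ.≮⇒≥ p≮n)))
    ... | a , b | inj₁ u = inj₂ (trans (sym b) (trans u (cong suc a)))
    ... | a , b | inj₂ d = inj₁ (trans (sym a) (trans d (cong suc b)))

  -- Every step changes the height by one. Hence the level of an element, which is odd, is met at
  -- odd positions only, that is, at elements.
  profile-parity : ∀ {p} → p ≤ double n → isOdd (H p) ≡ isOdd p
  profile-parity {zero}  _ = refl
  profile-parity {suc p} p<2n with profile-step p<2n
  ... | inj₁ u = trans (cong isOdd u) (cong not (profile-parity (ℕ.<⇒≤ p<2n)))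
  ... | inj₂ d = not-injective (trans (sym (cong isOdd d)) (trans (profile-parity (ℕ.<⇒≤ p<2n)) (sym (not-involutive _))))

  -- A discrete intermediate value argument, searching backwards from `m`; it ends because the path
  -- starts at height 0.
  last-visit : ∀ m {v} → m ≤ double n → v < H m → ∃[ q ] q < m × H q ≡ v × (∀ r → q < r → r ≤ m → v < H r)
  last-visit (suc m) {v} m<2n v<H with profile-step m<2n | H m ℕ.≤? v
  ... | _      | no  H≰v with last-visit m (ℕ.<⇒≤ m<2n) (ℕ.≰⇒> H≰v)
  ...   | q , q<m , Hq≡v , above = q , ℕ.m<n⇒m<1+n q<m , Hq≡v , extend
    where
    extend : ∀ r → q < r → r ≤ suc m → v < H r
    extend r q<r r≤1+m with ℕ.m≤n⇒m<n∨m≡n r≤1+m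
    ... | inj₁ r<1+m = above r q<r (ℕ.≤-pred r<1+m)
    ... | inj₂ refl  = v<H
  last-visit (suc m) {v} m<2n v<H | inj₁ u | yes H≤v =
    m , ℕ.≤-refl , ℕ.≤-antisym H≤v (ℕ.≤-pred (subst (v <_) u v<H)) ,
    λ r m<r r≤1+m → subst (λ r → v < H r) (ℕ.≤-antisym m<r r≤1+m) v<H
  last-visit (suc m) {v} m<2n v<H | inj₂ d | yes H≤v =
    contradiction (ℕ.<-trans v<H (ℕ.≤-reflexive (sym d))) (ℕ.≤⇒≯ H≤v)

  up⇒first : ∀ {k} → Up H (double k) → ¬ NotFirst π k
  up⇒first {k} u (i , j , refl , j<i , (e , above)) = ℕ.<-irrefl e
    (ℕ.≤-<-trans (above (double k) (inj₁ (ℕ.<⇒≤ (double-mono-≤ j<i) , ℕ.n≤1+n _))) (ℕ.≤-reflexive (sym u)))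

  -- The down step descends to the level of `k` from above. The last earlier visit to that level is
  -- at an element, by parity, and the path stays higher in between, so this element sees `k`.
  down⇒notFirst : ∀ {k} → k < n → Down H (double k) → NotFirst π k
  down⇒notFirst {k} k<n d with last-visit (double k) (double-mono-≤ (ℕ.<⇒≤ k<n)) (ℕ.≤-reflexive (sym d))
  ... | q , q<2k , Hq≡v , above = found (halve q) q<2k Hq≡v above
    where
    odd-q : isOdd (H (suc (double k))) ≡ true
    odd-q = trans (profile-parity (ℕ.≤-trans (ℕ.n≤1+n _) (double-mono-≤ k<n))) (cong not (isOdd-double k))
    found : ∀ {q} → Halved q → q < double k → H q ≡ H (suc (double k)) →
            (∀ r → q < r → r ≤ double k → H (suc (double k)) < H r) → NotFirst π k
    found (even l) q<2k e above = contradiction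
      (trans (sym odd-q) (trans (cong isOdd (sym e)) (trans (profile-parity (ℕ.≤-trans (ℕ.<⇒≤ q<2k) (double-mono-≤ (ℕ.<⇒≤ k<n)))) (isOdd-double l)))) λ ()
    found (odd l) q<2k e above = i , j , toℕ-fromℕ< k<n , subst (_< k) (sym (toℕ-fromℕ< l<n)) l<k ,
      subst₂ (Visible H) (cong (suc ∘ double) (sym (toℕ-fromℕ< l<n))) (cong (suc ∘ double) (sym (toℕ-fromℕ< k<n))) (e , visible)
      where
      l<k : l < k
      l<k = double-cancel-< (ℕ.<-trans (ℕ.n<1+n _) q<2k)
      l<n : l < n
      l<n = ℕ.<-trans l<k k<n
      i j : Fin n
      i = fromℕ< k<n
      j = fromℕ< l<n
      visible : ∀ r → Between (suc (double l)) r (suc (double k)) → H (suc (double l)) ≤ H r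
      visible r (inj₂ (a , b)) = contradiction (ℕ.≤-trans a b) (ℕ.<⇒≱ (ℕ.<-trans q<2k (ℕ.n<1+n _)))
      visible r (inj₁ (a , b)) with ℕ.m≤n⇒m<n∨m≡n a | ℕ.m≤n⇒m<n∨m≡n b
      ... | inj₂ refl | _         = ℕ.≤-refl
      ... | _         | inj₂ refl = ℕ.≤-reflexive e
      ... | inj₁ a<   | inj₁ b<   = subst (_≤ H r) (sym e) (ℕ.<⇒≤ (above r a< (ℕ.≤-pred b<)))

  up⇒¬does : ∀ {k} → Up H (double k) → does (notFirst? π k) ≡ false
  up⇒¬does {k} u = dec-false (notFirst? π k) (up⇒first u)

  down⇒does : ∀ {k} → k < n → Down H (double k) → does (notFirst? π k) ≡ true
  down⇒does {k} k<n d = dec-true (notFirst? π k) (down⇒notFirst k<n d)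

  steps-levels : ∀ {p} → p < n → steps π p ≡ letter w p
  steps-levels {p} p<n = by-parity (halve p) p<n
    where
    by-parity : ∀ {p} → Halved p → p < n → steps π p ≡ letter w p
    by-parity (even k) p<n with letter w (double k) in l
    ... | true  = trans (steps-even π k) (cong not (up⇒¬does (profile-up p<n l)))
    ... | false = trans (steps-even π k) (cong not (down⇒does (ℕ.≤-<-trans (n≤double-n k) p<n) (profile-down p<n l)))
    -- Odd letters are read off at the mirror image of `k`, where the step is reversed: up here
    -- means down there.
    by-parity (odd k) p<n with letter w (suc (double k)) in l
    ... | true  = trans (steps-odd π k) (down⇒does k′<n (trans (proj₁ mirror) (trans (profile-up p<n l) (cong suc (sym (proj₂ mirror))))))
      where
      k<n : k < n
      k<n = ℕ.≤-<-trans (ℕ.≤-trans (n≤double-n k) (ℕ.n≤1+n _)) p<n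
      k′<n : n ∸ suc k < n
      k′<n = ℕ.∸-monoʳ-< {n} (s≤s z≤n) k<n
      mirror : H (double (n ∸ suc k)) ≡ H (suc (suc (double k))) × H (suc (double (n ∸ suc k))) ≡ H (suc (double k))
      mirror = profile-mirror (double-mono-≤ k<n) (double-∸-suc k<n)
    ... | false = trans (steps-odd π k) (up⇒¬does {n ∸ suc k} (trans (proj₂ mirror) (trans (profile-down p<n l) (cong suc (sym (proj₁ mirror))))))
      where
      k<n : k < n
      k<n = ℕ.≤-<-trans (ℕ.≤-trans (n≤double-n k) (ℕ.n≤1+n _)) p<n
      mirror : H (double (n ∸ suc k)) ≡ H (suc (suc (double k))) × H (suc (double (n ∸ suc k))) ≡ H (suc (double k))
      mirror = profile-mirror (double-mono-≤ k<n) (double-∸-suc k<n)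

-- Heights along a word, and Dyck words.

step : Bool → ℕ → ℕ
step true  = suc
step false = pred

-- Down steps apply `pred`, which stops at 0; `dyck-down` shows that inside a Dyck word they really
-- descend.
run : (ℕ → Bool) → ℕ → ℕ → ℕ
run L h zero    = h
run L h (suc p) = run (L ∘ suc) (step (L 0) h) p

run-suc : ∀ L h p → run L h (suc p) ≡ step (L p) (run L h p)
run-suc L h zero    = refl
run-suc L h (suc p) = run-suc (L ∘ suc) (step (L 0) h) p

-- A step below height 0 is replaced by an upward one.
fromLetters : (ℕ → Bool) → ∀ h n → Path h n
fromLetters L h zero    = []
fromLetters L h (suc n) with L 0 | h
... | true  | h     = up (fromLetters (L ∘ suc) (suc h) n)
... | false | suc h = down (fromLetters (L ∘ suc) h n)
... | false | zero  = up (fromLetters (L ∘ suc) 1 n)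

fromLetters-letter : ∀ {h n} L (w : Path h n) → (∀ {p} → p < n → L p ≡ letter w p) → fromLetters L h n ≡ w
fromLetters-letter L []       eq = refl
fromLetters-letter L (up w)   eq with L 0 | eq {0} (s≤s z≤n)
... | .true  | refl = cong up (fromLetters-letter (L ∘ suc) w (λ p<n → eq (s≤s p<n)))
fromLetters-letter L (down w) eq with L 0 | eq {0} (s≤s z≤n)
... | .false | refl = cong down (fromLetters-letter (L ∘ suc) w (λ p<n → eq (s≤s p<n)))

height-fromLetters : ∀ L h n → (∀ {p} → p < n → L p ≡ false → run L h p ≢ 0) →
                     ∀ {p} → p ≤ n → height (fromLetters L h n) p ≡ run L h p
height-fromLetters L h n       _  {zero}  _         = refl
height-fromLetters L h (suc n) ok {suc p} (s≤s p≤n) with L 0 | h | ok {0} (s≤s z≤n) | (λ {p} (p<n : p < n) → ok {suc p} (s≤s p<n))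
... | true  | h     | _   | ok′ = height-fromLetters (L ∘ suc) (suc h) n ok′ p≤n
... | false | suc h | _   | ok′ = height-fromLetters (L ∘ suc) h n ok′ p≤n
... | false | zero  | 0≢0 | ok′ = contradiction refl (0≢0 refl)

-- The letters from `p` up to but excluding `q` form a Dyck word, given by its first-return
-- decomposition.
data Dyck (L : ℕ → Bool) : ℕ → ℕ → Set where
  empty : ∀ {p} → Dyck L p p
  arch  : ∀ {p q r} → L p ≡ true → Dyck L (suc p) q → L q ≡ false → Dyck L (suc q) r → Dyck L p r

module _ (L : ℕ → Bool) where

  private
    H : ℕ → ℕ
    H = run L 0

  run-up : ∀ {p} → L p ≡ true → Up H p
  run-up {p} l = trans (run-suc L 0 p) (cong (λ b → step b (H p)) l)

  run-pred : ∀ {p} → L p ≡ false → H (suc p) ≡ pred (H p)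
  run-pred {p} l = trans (run-suc L 0 p) (cong (λ b → step b (H p)) l)

  dyck-≤ : ∀ {p q} → Dyck L p q → p ≤ q
  dyck-≤ empty = ℕ.≤-refl
  dyck-≤ (arch _ D _ E) = ℕ.≤-trans (ℕ.≤-trans (ℕ.n≤1+n _) (dyck-≤ D)) (ℕ.≤-trans (ℕ.n≤1+n _) (dyck-≤ E))

  dyck-end : ∀ {p q} → Dyck L p q → H q ≡ H p
  arch-end : ∀ {p q} → L p ≡ true → Dyck L (suc p) q → L q ≡ false → H (suc q) ≡ H p

  dyck-end empty = refl
  dyck-end (arch u D d E) = trans (dyck-end E) (arch-end u D d)

  arch-end u D d = trans (run-pred d) (cong pred (trans (dyck-end D) (run-up u)))

  dyck-above : ∀ {p q} → Dyck L p q → ∀ {r} → p ≤ r → r ≤ q → H p ≤ H r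
  dyck-above empty p≤r r≤p = ℕ.≤-reflexive (cong H (ℕ.≤-antisym p≤r r≤p))
  dyck-above {p} (arch {q = q} u D d E) {r} p≤r r≤ with ℕ.m≤n⇒m<n∨m≡n p≤r | r ℕ.≤? q
  ... | inj₂ refl | _ = ℕ.≤-refl
  ... | inj₁ p<r  | yes r≤q = ℕ.≤-trans (ℕ.≤-trans (ℕ.n≤1+n _) (ℕ.≤-reflexive (sym (run-up u)))) (dyck-above D p<r r≤q)
  ... | inj₁ p<r  | no  r≰q = subst (_≤ H r) (arch-end u D d) (dyck-above E (ℕ.≰⇒> r≰q) r≤)

  dyck-down : ∀ {p q} → Dyck L p q → ∀ {r} → p ≤ r → r < q → L r ≡ false → Down H r
  dyck-down empty p≤r r<p _ = contradiction p≤r (ℕ.<⇒≱ r<p)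
  dyck-down (arch {q = q} u D d E) {r} p≤r r< l with ℕ.m≤n⇒m<n∨m≡n p≤r | ℕ.<-cmp r q
  ... | inj₂ refl | _ = contradiction (trans (sym l) u) λ ()
  ... | inj₁ p<r  | tri< r<q _ _ = dyck-down D p<r r<q l
  ... | inj₁ p<r  | tri≈ _ refl _ = trans (trans (dyck-end D) (run-up u)) (cong suc (sym (arch-end u D d)))
  ... | inj₁ p<r  | tri> _ _ q<r = dyck-down E q<r r< l

-- From a self-complementary noncrossing partition to its Dyck path.

module FromPartition {n : ℕ} {π : Partition n} (nc : NonCrossing π) (Cπ≈π : 𝐂 π ≈ π) where

  open Part π

  L : ℕ → Bool
  L = steps π

  H : ℕ → ℕ
  H = run L 0

  HasNext : Fin n → Fin n → Set
  HasNext i j = i Fin.< j × i ~ j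

  hasNext? : ∀ i j → Dec (HasNext i j)
  hasNext? i j = (toℕ i ℕ.<? toℕ j) ×-dec (i ~? j)

  𝐂-~ : ∀ {i j} → i ~ j → opposite i ~ opposite j
  𝐂-~ {i} {j} = from (Cπ≈π i j)

  L-first : ∀ i → (∀ j → j ~ i → i Fin.≤ j) → L (double (toℕ i)) ≡ true
  L-first i first = trans (steps-even π (toℕ i)) (cong not (dec-false (notFirst? π (toℕ i))
    λ (k , j , k≡i , j<i , j~k) → ℕ.<⇒≱ j<i (first j (subst (j ~_) (toℕ-injective k≡i) j~k))))

  L-notFirst : ∀ {i j} → HasNext j i → L (double (toℕ i)) ≡ false
  L-notFirst {i} {j} (j<i , j~i) = trans (steps-even π (toℕ i)) (cong not (dec-true (notFirst? π (toℕ i)) (i , j , refl , j<i , j~i)))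

  L-next : ∀ {i j} → HasNext i j → L (position i) ≡ true
  L-next {i} {j} (i<j , i~j) = trans (steps-odd π (toℕ i)) (dec-true (notFirst? π (n ∸ suc (toℕ i)))
    (opposite i , opposite j , opposite-prop i , subst (toℕ (opposite j) <_) (opposite-prop i) (opposite-mono-< i<j) , 𝐂-~ (~-sym i~j)))

  L-last : ∀ i → (∀ j → ¬ HasNext i j) → L (position i) ≡ false
  L-last i last = trans (steps-odd π (toℕ i)) (dec-false (notFirst? π (n ∸ suc (toℕ i)))
    λ (k , j , k≡ , j< , j~k) → let k≡oi = toℕ-injective (trans k≡ (sym (opposite-prop i))) in
      last (opposite j)
        ( subst (Fin._< opposite j) (opposite-involutive i)
            (opposite-mono-< (subst (toℕ j <_) (sym (opposite-prop i)) j<))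
        , subst (_~ opposite j) (opposite-involutive i) (𝐂-~ (~-sym (subst (j ~_) k≡oi j~k)))))

  Next : Fin n → Fin n → Set
  Next i z = HasNext i z × (∀ j → HasNext i j → z Fin.≤ j)

  next : ∀ {i j} → HasNext i j → ∃[ z ] Next i z
  next {i} {j} h = least (hasNext? i) (j , h)

  -- [x,y) is a union of blocks.
  Closed : ℕ → ℕ → Set
  Closed x y = ∀ a b → x ≤ toℕ a → toℕ a < y → a ~ b → x ≤ toℕ b × toℕ b < y

  -- [i,y) is a union of blocks, except that the block of i may contain elements
  -- smaller than i.
  ClosedFrom : Fin n → ℕ → Set
  ClosedFrom i y = ∀ a b → i Fin.≤ a → toℕ a < y → a ~ b → toℕ b < y × (i Fin.≤ b ⊎ i ~ a)

  -- An element strictly between two consecutive elements of a block belongs to another block;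
  -- leaving the gap, that block would cross the first.
  between-closed : ∀ {i z} → Next i z → Closed (suc (toℕ i)) (toℕ z)
  between-closed {i} {z} ((i<z , i~z) , least-z) a b i<a a<z a~b = after (toℕ i ℕ.<? toℕ b) , before (toℕ b ℕ.<? toℕ z)
    where
    i≁a : ¬ i ~ a
    i≁a i~a = ℕ.<⇒≱ a<z (least-z a (i<a , i~a))
    after : Dec (i Fin.< b) → i Fin.< b
    after (yes i<b) = i<b
    after (no  i≮b) with ℕ.m≤n⇒m<n∨m≡n (ℕ.≮⇒≥ i≮b)
    ... | inj₁ b<i = ⊥-elim (nc b i a z b<i i<a a<z (~-sym a~b , i~z , λ b~i → i≁a (~-trans (~-sym b~i) (~-sym a~b))))
    ... | inj₂ b≡i = contradiction (~-sym (subst (a ~_) (toℕ-injective b≡i) a~b)) i≁a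
    before : Dec (b Fin.< z) → b Fin.< z
    before (yes b<z) = b<z
    before (no  b≮z) with ℕ.m≤n⇒m<n∨m≡n (ℕ.≮⇒≥ b≮z)
    ... | inj₁ z<b = ⊥-elim (nc i a z b i<a a<z z<b (i~z , a~b , i≁a))
    ... | inj₂ z≡b = contradiction (~-trans i~z (~-sym (subst (a ~_) (toℕ-injective (sym z≡b)) a~b))) i≁a

  -- Mutual induction with `d` bounding the number of elements left. A union of blocks starts with
  -- the opening up step of a block, and `block-dyck` continues just after it: each gap between
  -- consecutive elements contributes an arch, and the down step after the last element, at `q`,
  -- closes the opening step.
  closed-dyck : ∀ d x y → y ≤ d + x → x ≤ y → y ≤ n → Closed x y → Dyck L (double x) (double y)
  block-dyck  : ∀ d i y → y ≤ d + suc (toℕ i) → toℕ i < y → y ≤ n → ClosedFrom i y →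
                ∃[ q ] Dyck L (position i) q × L q ≡ false × Dyck L (suc q) (double y)

  closed-dyck d x y y≤d+x x≤y y≤n closed with ℕ.m≤n⇒m<n∨m≡n x≤y
  ... | inj₂ refl = empty
  closed-dyck zero    x y y≤x   _ _   _      | inj₁ x<y = contradiction y≤x (ℕ.<⇒≱ x<y)
  closed-dyck (suc d) x y y≤d+x _ y≤n closed | inj₁ x<y =
    let q , D , l , E = block-dyck d i y
          (subst (λ x → y ≤ d + suc x) (sym i≡x) (subst (y ≤_) (sym (ℕ.+-suc d x)) y≤d+x))
          (subst (_< y) (sym i≡x) x<y) y≤n
          (λ a b i≤a a<y a~b → let x≤b , b<y = closed a b (subst (_≤ toℕ a) i≡x i≤a) a<y a~b
                               in b<y , inj₁ (subst (_≤ toℕ b) (sym i≡x) x≤b))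
    in arch (subst (λ x → L (double x) ≡ true) i≡x (L-first i first))
         (subst (λ x → Dyck L (suc (double x)) q) i≡x D) l E
    where
    i : Fin n
    i = fromℕ< (ℕ.<-≤-trans x<y y≤n)
    i≡x : toℕ i ≡ x
    i≡x = toℕ-fromℕ< (ℕ.<-≤-trans x<y y≤n)
    first : ∀ j → j ~ i → i Fin.≤ j
    first j j~i = subst (_≤ toℕ j) (sym i≡x)
      (proj₁ (closed i j (ℕ.≤-reflexive (sym i≡x)) (subst (_< y) (sym i≡x) x<y) (~-sym j~i)))

  block-dyck d i y y≤ i<y y≤n closed with any? (hasNext? i)
  ... | no last = position i , empty , L-last i (λ j h → last (j , h)) ,
        closed-dyck d (suc (toℕ i)) y y≤ i<y y≤n closed′
    where
    closed′ : Closed (suc (toℕ i)) y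
    closed′ a b i<a a<y a~b with closed a b (ℕ.<⇒≤ i<a) a<y a~b
    ... | _   , inj₂ i~a = contradiction (a , i<a , i~a) last
    ... | b<y , inj₁ i≤b = ℕ.≤∧≢⇒< i≤b
            (λ i≡b → last (a , i<a , ~-sym (subst (a ~_) (toℕ-injective (sym i≡b)) a~b))) , b<y
  ... | yes (_ , h) with next h
  ...   | z , nz@((i<z , i~z) , least-z) = continue d y≤
    where
    z<y : toℕ z < y
    z<y = proj₁ (closed i z ℕ.≤-refl i<y i~z)
    closed′ : ClosedFrom z y
    closed′ a b z≤a a<y a~b with closed a b (ℕ.≤-trans (ℕ.<⇒≤ i<z) z≤a) a<y a~b
    ... | b<y , inj₂ i~a = b<y , inj₂ (~-trans (~-sym i~z) i~a)
    ... | b<y , inj₁ i≤b with toℕ z ℕ.≤? toℕ b | ℕ.m≤n⇒m<n∨m≡n i≤b | ℕ.m≤n⇒m<n∨m≡n z≤a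
    ...   | yes z≤b | _        | _ = b<y , inj₁ z≤b
    ...   | no _    | inj₂ i≡b | _ = b<y , inj₂ (~-trans (~-sym i~z) (~-sym (subst (a ~_) (toℕ-injective (sym i≡b)) a~b)))
    ...   | no _    | _ | inj₂ z≡a = b<y , inj₂ (subst (z ~_) (toℕ-injective z≡a) ~-refl)
    ...   | no z≰b  | inj₁ i<b | inj₁ z<a = ⊥-elim (nc i b z a i<b (ℕ.≰⇒> z≰b) z<a
              (i~z , ~-sym a~b , λ i~b → z≰b (least-z b (i<b , i~b))))
    continue : ∀ d → y ≤ d + suc (toℕ i) → ∃[ q ] Dyck L (position i) q × L q ≡ false × Dyck L (suc q) (double y)
    continue zero    y≤ = contradiction (ℕ.<-≤-trans z<y y≤) (ℕ.≤⇒≯ i<z)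
    continue (suc d) y≤ =
      let q , D , l , E = block-dyck d z y
            (ℕ.≤-trans y≤ (subst (_≤ d + suc (toℕ z)) (ℕ.+-suc d (suc (toℕ i))) (ℕ.+-monoʳ-≤ d (s≤s i<z)))) z<y y≤n closed′
      in q , arch (L-next (i<z , i~z))
               (closed-dyck d (suc (toℕ i)) (toℕ z) (ℕ.≤-pred (ℕ.<-≤-trans z<y y≤)) i<z (ℕ.<⇒≤ (toℕ<n z)) (between-closed nz))
               (L-notFirst (i<z , i~z)) D , l , E

  dyck : Dyck L 0 (double n)
  dyck = closed-dyck n 0 n (ℕ.m≤m+n n 0) z≤n ℕ.≤-refl (λ a b _ _ _ → z≤n , toℕ<n b)

  H-down : ∀ {p} → p < double n → L p ≡ false → Down H p
  H-down = dyck-down L dyck z≤n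

  next-dyck : ∀ {i z} → Next i z → Dyck L (suc (position i)) (double (toℕ z))
  next-dyck {i} {z} nz@((i<z , _) , _) =
    closed-dyck (toℕ z) (suc (toℕ i)) (toℕ z) (ℕ.m≤m+n _ _) i<z (ℕ.<⇒≤ (toℕ<n z)) (between-closed nz)

  -- From `i` to `z` the path makes exactly one arch, over the gap between them.
  next-visible : ∀ {i z} → Next i z → Visible H (position i) (position z)
  next-visible {i} {z} nz@((i<z , i~z) , _) = sym end , above
    where
    end : H (position z) ≡ H (position i)
    end = arch-end L (L-next (i<z , i~z)) (next-dyck nz) (L-notFirst (i<z , i~z))
    above : ∀ r → Between (position i) r (position z) → H (position i) ≤ H r
    above r (inj₂ (z≤r , r≤i)) = contradiction (ℕ.≤-trans z≤r r≤i) (ℕ.<⇒≱ (s≤s (ℕ.≤-trans (ℕ.n≤1+n _) (double-mono-≤ i<z))))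
    above r (inj₁ (i≤r , r≤z)) with ℕ.m≤n⇒m<n∨m≡n i≤r | ℕ.m≤n⇒m<n∨m≡n r≤z
    ... | inj₂ refl | _         = ℕ.≤-refl
    ... | _         | inj₂ refl = ℕ.≤-reflexive (sym end)
    ... | inj₁ i<r  | inj₁ r<z  = ℕ.≤-trans (ℕ.≤-trans (ℕ.n≤1+n _) (ℕ.≤-reflexive (sym (run-up L {position i} (L-next (i<z , i~z))))))
                                    (dyck-above L (next-dyck nz) i<r (ℕ.≤-pred r<z))

  ~⇒visible-< : ∀ d {i j} → toℕ j ≤ d + toℕ i → HasNext i j → Visible H (position i) (position j)
  ~⇒visible-< zero    j≤i (i<j , _) = contradiction j≤i (ℕ.<⇒≱ i<j)
  ~⇒visible-< (suc d) {i} {j} j≤ h@(i<j , i~j) with next h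
  ... | z , nz@((i<z , i~z) , least-z) with ℕ.m≤n⇒m<n∨m≡n (least-z j h)
  ...   | inj₂ z≡j = subst (λ z → Visible H (position i) (position z)) (toℕ-injective z≡j) (next-visible nz)
  ...   | inj₁ z<j = visible-trans H (next-visible nz) (~⇒visible-< d
            (ℕ.≤-trans j≤ (subst (_≤ d + toℕ z) (ℕ.+-suc d (toℕ i)) (ℕ.+-monoʳ-≤ d i<z))) (z<j , ~-trans (~-sym i~z) i~j))

  -- Walk along the block of `i`. If it ends before `j`, the path drops below the level right after
  -- its last element; if it jumps over `j`, then `j` is inside an arch and strictly higher. So the
  -- walk meets `j`.
  visible⇒~-< : ∀ d {i j} → toℕ j ≤ d + toℕ i → i Fin.< j → Visible H (position i) (position j) → i ~ j
  visible⇒~-< zero    j≤i i<j _ = contradiction j≤i (ℕ.<⇒≱ i<j)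
  visible⇒~-< (suc d) {i} {j} j≤ i<j (e , above) with any? (hasNext? i)
  ... | no last = contradiction (above (suc (position i)) (inj₁ (ℕ.n≤1+n _ , ℕ.≤-trans (double-mono-≤ i<j) (ℕ.n≤1+n _))))
                    (ℕ.<⇒≱ (ℕ.≤-reflexive (sym (H-down (double-mono-≤ (toℕ<n i)) (L-last i λ j h → last (j , h))))))
  ... | yes (_ , h) with next h
  ...   | z , nz@((i<z , i~z) , _) with ℕ.<-cmp (toℕ z) (toℕ j)
  ...     | tri≈ _ z≡j _ = subst (i ~_) (toℕ-injective z≡j) i~z
  ...     | tri< z<j _ _ = ~-trans i~z (visible⇒~-< d
              (ℕ.≤-trans j≤ (subst (_≤ d + toℕ z) (ℕ.+-suc d (toℕ i)) (ℕ.+-monoʳ-≤ d i<z))) z<j (trans (sym Hi≡Hz) e , λ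
                { r (inj₁ (z≤r , r≤j)) → subst (_≤ H r) Hi≡Hz (above r (inj₁ (ℕ.≤-trans (position-mono (ℕ.<⇒≤ i<z)) z≤r , r≤j)))
                ; r (inj₂ (j≤r , r≤z)) → contradiction (ℕ.≤-trans j≤r r≤z) (ℕ.<⇒≱ (s≤s (ℕ.≤-trans (ℕ.n≤1+n _) (double-mono-≤ z<j)))) }))
    where
    Hi≡Hz : H (position i) ≡ H (position z)
    Hi≡Hz = proj₁ (next-visible nz)
  ...     | tri> _ _ j<z = contradiction e (ℕ.<⇒≢ (ℕ.<-≤-trans (ℕ.≤-reflexive (sym (run-up L {position i} (L-next (i<z , i~z)))))
              (dyck-above L (next-dyck nz) (ℕ.≤-trans (double-mono-≤ i<j) (ℕ.n≤1+n _)) (ℕ.≤-trans (ℕ.n≤1+n _) (double-mono-≤ j<z)))))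

  visible⇔~ : ∀ i j → Visible H (position i) (position j) ⇔ i ~ j
  visible⇔~ i j with ℕ.<-cmp (toℕ i) (toℕ j)
  ... | tri< i<j _ _ = mk⇔ (visible⇒~-< (toℕ j) (ℕ.m≤m+n _ _) i<j) (λ i~j → ~⇒visible-< (toℕ j) (ℕ.m≤m+n _ _) (i<j , i~j))
  ... | tri> _ _ j<i = mk⇔ (λ v → ~-sym (visible⇒~-< (toℕ i) (ℕ.m≤m+n _ _) j<i (visible-sym H v)))
                           (λ i~j → visible-sym H (~⇒visible-< (toℕ i) (ℕ.m≤m+n _ _) (j<i , ~-sym i~j)))
  ... | tri≈ _ i≡j _ = mk⇔ (λ _ → subst (i ~_) (toℕ-injective i≡j) ~-refl)
                           (λ _ → subst (λ j → Visible H (position i) (position j)) (toℕ-injective i≡j) (visible-refl H (position i)))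

  -- Built into `steps`, which reads its odd letters off at the mirror image.
  L-mirror : ∀ {p} → p < double n → L (double n ∸ suc p) ≡ not (L p)
  L-mirror {p} p<2n with halve p
  ... | even k = begin
    L (double n ∸ suc (double k))              ≡⟨ cong L (double-∸-suc k<n) ⟩
    L (suc (double (n ∸ suc k)))               ≡⟨ steps-odd π (n ∸ suc k) ⟩
    does (notFirst? π (n ∸ suc (n ∸ suc k)))   ≡⟨ cong (λ k → does (notFirst? π k)) (ℕ.suc-injective (trans (sym (ℕ.+-∸-assoc 1 (ℕ.∸-monoʳ-< {n} (s≤s z≤n) k<n))) (ℕ.m∸[m∸n]≡n k<n))) ⟩
    does (notFirst? π k)                       ≡⟨ not-involutive _ ⟨
    not (not (does (notFirst? π k)))           ≡⟨ cong not (steps-even π k) ⟨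
    not (L (double k))                         ∎
    where
    open ≡-Reasoning
    k<n : k < n
    k<n = double-cancel-< p<2n
  ... | odd k = begin
    L (double n ∸ double (suc k))              ≡⟨ cong L (double-∸ n (suc k)) ⟩
    L (double (n ∸ suc k))                     ≡⟨ steps-even π (n ∸ suc k) ⟩
    not (does (notFirst? π (n ∸ suc k)))       ≡⟨ cong not (steps-odd π k) ⟨
    not (L (suc (double k)))                   ∎
    where open ≡-Reasoning

  H-mirror : ∀ {p} → p ≤ double n → H (double n ∸ p) ≡ H p
  H-mirror {zero}  _    = dyck-end L dyck
  H-mirror {suc p} p<2n = by-letter (L p) refl
    where
    q : ℕ
    q = double n ∸ suc p
    1+q : suc q ≡ double n ∸ p
    1+q = sym (ℕ.+-∸-assoc 1 p<2n)
    q<2n : q < double n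
    q<2n = ℕ.∸-monoʳ-< {double n} (s≤s z≤n) p<2n
    IH : H (suc q) ≡ H p
    IH = trans (cong H 1+q) (H-mirror (ℕ.<⇒≤ p<2n))
    by-letter : ∀ b → L p ≡ b → H q ≡ H (suc p)
    by-letter true  l = trans (H-down q<2n (trans (L-mirror p<2n) (cong not l))) (trans (cong suc IH) (sym (run-up L {p} l)))
    by-letter false l = ℕ.suc-injective (trans (sym (run-up L {q} (trans (L-mirror p<2n) (cong not l)))) (trans IH (H-down p<2n l)))

  word : Path 0 n
  word = fromLetters L 0 n

  height≡H : ∀ {p} → p ≤ n → height word p ≡ H p
  -- In `word` a down step at height 0 would be replaced; the Dyck structure rules such steps out.
  height≡H = height-fromLetters L 0 n λ p<n l Hp≡0 →
    contradiction (trans (sym Hp≡0) (H-down (ℕ.<-≤-trans p<n (n≤double-n n)) l)) λ ()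

  profile≡H : ∀ {p} → p ≤ double n → mirrored n (height word) p ≡ H p
  profile≡H {p} p≤2n with ℕ.≤-total p n
  ... | inj₁ p≤n = trans (mirrored-≤ n (height word) p≤n) (height≡H p≤n)
  ... | inj₂ n≤p = begin
    mirrored n (height word) p               ≡⟨ mirrored-mirror n (height word) p≤2n ⟨
    mirrored n (height word) (double n ∸ p)  ≡⟨ mirrored-≤ n (height word) 2n∸p≤n ⟩
    height word (double n ∸ p)               ≡⟨ height≡H 2n∸p≤n ⟩
    H (double n ∸ p)                         ≡⟨ H-mirror p≤2n ⟩
    H p                                      ∎
    where
    open ≡-Reasoning
    2n∸p≤n : double n ∸ p ≤ n
    2n∸p≤n = subst (double n ∸ p ≤_) (double-n∸n n) (ℕ.∸-monoʳ-≤ (double n) n≤p)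

  levels-word : levels n (mirrored n (height word)) ≈ π
  levels-word i j = mk⇔
    (λ v → to (visible⇔~ i j) (visible-resp profile≡H (position≤ i) (position≤ j) v))
    (λ i~j → visible-resp (λ p≤ → sym (profile≡H p≤)) (position≤ i) (position≤ j) (from (visible⇔~ i j) i~j))

paths→fixedPartitions : ∀ n → Bijection (setoid (Path 0 n)) (selfComplementaryNCs n)
paths→fixedPartitions n = record
  { to        = toNC
  ; cong      = λ { {w} refl → ≈.refl {x = SelfComplementaryNC.partition (toNC w)} }
  ; bijective = (λ {w} {w′} → injective w w′) , λ s → word s , λ { refl → levels-word s }
  }
  where
  open module F s = FromPartition {n} {SelfComplementaryNC.partition s} (SelfComplementaryNC.nonCrossing s) (SelfComplementaryNC.selfComplementary s)
    using (word; levels-word)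
  partition : Path 0 n → Partition n
  partition w = levels n (mirrored n (height w))
  toNC : Path 0 n → SelfComplementaryNC n
  toNC w = record
    { partition         = partition w
    ; nonCrossing       = levels-nonCrossing (mirrored n (height w))
    ; selfComplementary = levels-𝐂 n (mirrored n (height w)) (mirrored-mirror n (height w))
    }
  injective : ∀ w w′ → partition w ≈ partition w′ → w ≡ w′
  injective w w′ eq = trans (sym (fromLetters-letter (steps (partition w)) w (steps-levels w)))
    (fromLetters-letter (steps (partition w)) w′
      (λ {p} p<n → trans (steps-cong {π = partition w} {partition w′} eq p) (steps-levels w′ p<n)))

-- Orbits

even⊎odd : ∀ m → (∃[ k ] m ≡ k + k) ⊎ (∃[ k ] m ≡ suc (k + k))
even⊎odd zero = inj₁ (0 , refl)
even⊎odd (suc m) with even⊎odd m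
... | inj₁ (k , refl) = inj₂ (k , refl)
... | inj₂ (k , refl) = inj₁ (suc k , cong suc (sym (ℕ.+-suc k k)))

even≢odd : ∀ j k → j + j ≢ suc (k + k)
even≢odd (suc j) k eq with k
... | zero  = contradiction (trans (sym (ℕ.+-suc j j)) (ℕ.suc-injective eq)) λ ()
... | suc k = even≢odd j k (ℕ.suc-injective (trans (sym (ℕ.+-suc j j)) (trans (ℕ.suc-injective eq) (cong suc (ℕ.+-suc k k)))))

+-double-injective : ∀ {j k} → j + j ≡ k + k → j ≡ k
+-double-injective {zero}  {zero}  eq = refl
+-double-injective {suc j} {suc k} eq = cong suc (+-double-injective (ℕ.suc-injective
  (trans (sym (ℕ.+-suc j j)) (trans (ℕ.suc-injective eq) (ℕ.+-suc k k)))))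

half-odd-multiple : ∀ {e j} → e ∣ j + j → ¬ e ∣ j → ∃[ s ] j + j ≡ suc (s + s) * e
half-odd-multiple {e} {j} (divides q j+j≡q*e) e∤j with even⊎odd q
... | inj₂ (s , refl) = s , j+j≡q*e
... | inj₁ (s , refl) = contradiction (divides s (+-double-injective (trans j+j≡q*e (ℕ.*-distribʳ-+ e s s)))) e∤j

-- As a divisor of an odd number, `e` is odd; and if `e` did not divide `j`, then `j + j` would be
-- an odd multiple of it.
∣-half : ∀ {e m j} → e ∣ suc (m + m) → e ∣ j + j → e ∣ j
∣-half {e} {m} {j} (divides q 1+2m≡q*e) e∣2j with e ∣? j
... | yes e∣j = e∣j
... | no  e∤j with half-odd-multiple e∣2j e∤j
...   | s , j+j≡[1+2s]e with even⊎odd q | even⊎odd e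
...     | inj₁ (r , refl) | _ = contradiction (trans (sym (ℕ.*-distribʳ-+ e r r)) (sym 1+2m≡q*e)) (even≢odd (r * e) m)
...     | _ | inj₁ (r , refl) = contradiction (trans (sym (ℕ.*-distribˡ-+ q r r)) (sym 1+2m≡q*e)) (even≢odd (q * r) m)
...     | _ | inj₂ (r , refl) = contradiction (trans j+j≡[1+2s]e (odd*odd s r)) (even≢odd j (s + r + s * (r + r)))
  where
  odd*odd : ∀ s r → suc (s + s) * suc (r + r) ≡ suc ((s + r + s * (r + r)) + (s + r + s * (r + r)))
  odd*odd = solve-∀

-- Both `i` and `j` are odd multiples of `e / 2`, and a sum of two odd numbers is even.
half-odd-multiples-add : ∀ {e i j} → e ∣ i + i → ¬ e ∣ i → e ∣ j + j → ¬ e ∣ j → e ∣ i + j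
half-odd-multiples-add {e} {i} {j} e∣2i e∤i e∣2j e∤j
  with half-odd-multiple e∣2i e∤i | half-odd-multiple e∣2j e∤j
... | s , p | t , q = divides (suc (s + t)) (+-double-injective (begin
  (i + j) + (i + j)                   ≡⟨ rearrange i j ⟩
  (i + i) + (j + j)                   ≡⟨ cong₂ _+_ p q ⟩
  suc (s + s) * e + suc (t + t) * e   ≡⟨ collect s t e ⟩
  suc (s + t) * e + suc (s + t) * e   ∎))
  where
  open ≡-Reasoning
  rearrange : ∀ i j → (i + j) + (i + j) ≡ (i + i) + (j + j)
  rearrange = solve-∀
  collect : ∀ s t e → suc (s + s) * e + suc (t + t) * e ≡ suc (s + t) * e + suc (s + t) * e
  collect = solve-∀

-- Orbits of a map of finite order and of its square.

fold-+ : ∀ {a} {A : Set a} (x : A) f m k → fold x f (m + k) ≡ fold (fold x f k) f m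
fold-+ x f zero    k = refl
fold-+ x f (suc m) k = cong f (fold-+ x f m k)

module Orbit {a ℓ} (S : Setoid a ℓ) (_≟_ : Decidable₂ (Setoid._≈_ S)) (f : Setoid.Carrier S → Setoid.Carrier S)
             (f-cong : ∀ {x y} → Setoid._≈_ S x y → Setoid._≈_ S (f x) (f y))
             (P : ℕ) .{{_ : NonZero P}} (f^P : ∀ x → Setoid._≈_ S (fold x f P) x) where

  open Setoid S using (Carrier) renaming (_≈_ to _≃_; refl to ≃-refl; sym to ≃-sym; trans to ≃-trans; reflexive to ≃-reflexive)

  infixr 8 f^_

  f^_ : ℕ → Carrier → Carrier
  (f^ m) x = fold x f m

  ^-cong : ∀ m {x y} → x ≃ y → (f^ m) x ≃ (f^ m) y
  ^-cong zero    x≃y = x≃y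
  ^-cong (suc m) x≃y = f-cong (^-cong m x≃y)

  ^-+ : ∀ m k x → (f^ (m + k)) x ≃ (f^ m) ((f^ k) x)
  ^-+ m k x = ≃-reflexive (fold-+ x f m k)

  ^-comm : ∀ m k x → (f^ m) ((f^ k) x) ≃ (f^ k) ((f^ m) x)
  ^-comm m k x = ≃-trans (≃-sym (^-+ m k x)) (≃-trans (≃-reflexive (cong (fold x f) (ℕ.+-comm m k))) (^-+ k m x))

  ^-multiple : ∀ {m x} → (f^ m) x ≃ x → ∀ q → (f^ (q * m)) x ≃ x
  ^-multiple         p zero    = ≃-refl
  ^-multiple {m} {x} p (suc q) = ≃-trans (^-+ m (q * m) x) (≃-trans (^-cong m (^-multiple p q)) p)

  f-injective : ∀ {x y} → f x ≃ f y → x ≃ y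
  f-injective {x} {y} p = ≃-trans (≃-sym (undo x)) (≃-trans (^-cong (pred P) p) (undo y))
    where
    undo : ∀ x → (f^ (pred P)) (f x) ≃ x
    undo x = ≃-trans (≃-sym (^-+ (pred P) 1 x))
      (≃-trans (≃-reflexive (cong (fold x f) (trans (ℕ.+-comm (pred P) 1) (ℕ.suc-pred P)))) (f^P x))

  ^-injective : ∀ m {x y} → (f^ m) x ≃ (f^ m) y → x ≃ y
  ^-injective zero    p = p
  ^-injective (suc m) p = ^-injective m (f-injective p)

  -- Exponents are natural numbers; `pred P * m` takes the place of `- m`.
  ^-undo : ∀ m x → (f^ m) ((f^ (pred P * m)) x) ≃ x
  ^-undo m x = ≃-trans (≃-sym (^-+ m (pred P * m) x))
    (≃-trans (≃-reflexive (cong (fold x f) (trans (cong (_* m) (ℕ.suc-pred P)) (ℕ.*-comm P m)))) (^-multiple (f^P x) m))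

  infix 4 _≋_

  _≋_ : Rel Carrier _
  x ≋ y = ∃[ m ] (f^ m) x ≃ y

  ≋-trans : ∀ {x y z} → x ≋ y → y ≋ z → x ≋ z
  ≋-trans {x} (m , p) (k , q) = k + m , ≃-trans (^-+ k m x) (≃-trans (^-cong k p) q)

  ≋-sym : ∀ {x y} → x ≋ y → y ≋ x
  ≋-sym {x} {y} (m , p) = pred P * m , ^-injective m (≃-trans (^-undo m y) (≃-sym p))

  reduce : ∀ {m k} .{{_ : NonZero m}} {x} → (f^ m) x ≃ x → (f^ k) x ≃ (f^ (k % m)) x
  reduce {m} {k} {x} p = ≃-trans (≃-reflexive (cong (fold x f) (m≡m%n+[m/n]*n k m)))
    (≃-trans (^-+ (k % m) (k / m * m) x) (^-cong (k % m) (^-multiple p (k / m))))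

  _≋?_ : Decidable₂ _≋_
  x ≋? y = map′ (λ (i , p) → toℕ i , p)
    (λ (m , p) → fromℕ< (m%n<n m P) ,
      ≃-trans (≃-reflexive (cong (fold x f) (toℕ-fromℕ< (m%n<n m P)))) (≃-trans (≃-sym (reduce {P} {m} (f^P x))) p))
    (any? {n = P} λ i → (f^ (toℕ i)) x ≟ y)

  period : ∀ x → ∃[ e ] NonZero e × (∀ {m} → (f^ m) x ≃ x ⇔ e ∣ m)
  period x with least {n = P} {P = λ i → (f^ (suc (toℕ i))) x ≃ x} (λ i → (f^ (suc (toℕ i))) x ≟ x)
                  (fromℕ< pred<P , ≃-trans (≃-reflexive (cong (λ k → f (fold x f k)) (toℕ-fromℕ< pred<P)))
                    (≃-trans (≃-reflexive (cong (fold x f) (ℕ.suc-pred P))) (f^P x)))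
    where
    pred<P : pred P < P
    pred<P = ℕ.≤-reflexive (ℕ.suc-pred P)
  ... | i , fix , smallest = suc (toℕ i) , _ , λ {m} → mk⇔ (returns m) (λ { (divides q refl) → ^-multiple fix q })
    where
    returns : ∀ m → (f^ m) x ≃ x → suc (toℕ i) ∣ m
    returns m p with m % suc (toℕ i) in eq
    ... | zero  = m%n≡0⇒n∣m m (suc (toℕ i)) eq
    ... | suc r = contradiction (smallest (fromℕ< r<P) back) (ℕ.<⇒≱ (subst (_< toℕ i) (sym (toℕ-fromℕ< r<P)) r<i))
      where
      r<i : r < toℕ i
      r<i = ℕ.≤-pred (subst (_< suc (toℕ i)) eq (m%n<n m (suc (toℕ i))))
      r<P : r < P
      r<P = ℕ.<-trans r<i (toℕ<n i)
      back : (f^ (suc (toℕ (fromℕ< r<P)))) x ≃ x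
      back = ≃-trans (≃-reflexive (cong (λ k → f (fold x f k)) (toℕ-fromℕ< r<P)))
        (≃-trans (≃-reflexive (cong (fold x f) (sym eq))) (≃-trans (≃-sym (reduce {suc (toℕ i)} {m} fix)) p))

  infix 4 _≃₂_

  _≃₂_ : Rel Carrier _
  x ≃₂ y = ∃[ j ] (f^ (j + j)) x ≃ y

  ≃₂-sym : ∀ {x y} → x ≃₂ y → y ≃₂ x
  ≃₂-sym {x} {y} (j , p) = pred P * j , ≃-trans (≃-reflexive (cong (fold y f) (sym (ℕ.*-distribˡ-+ (pred P) j j))))
    (^-injective (j + j) (≃-trans (^-undo (j + j) y) (≃-sym p)))

  ≃₂-trans : ∀ {x y z} → x ≃₂ y → y ≃₂ z → x ≃₂ z
  ≃₂-trans {x} (j , p) (i , q) = i + j ,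
    ≃-trans (≃-reflexive (cong (fold x f) (sym (interchange i j)))) (≃-trans (^-+ (i + i) (j + j) x) (≃-trans (^-cong (i + i) p) q))
    where
    interchange : ∀ i j → i + i + (j + j) ≡ i + j + (i + j)
    interchange = solve-∀

  -- The following is the case where Fix x means c x ≃ x for a map c with
  -- c ∘ f ≃ f⁻¹ ∘ c, so that f and c generate a dihedral action.
  module Reflection (Fix : Carrier → Set) (Fix-resp : ∀ {x y} → x ≃ y → Fix x → Fix y)
    (Fix-^ : ∀ {x} → Fix x → ∀ i → (f^ (i + i)) x ≃ x → Fix ((f^ i) x))
    (Fix-^⁻¹ : ∀ {x} → Fix x → ∀ i → Fix ((f^ i) x) → (f^ (i + i)) x ≃ x)
    {N} (element : Fin N → Carrier) (element-Fix : ∀ i → Fix (element i))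
    (number : ∀ {x} → Fix x → ∃[ i ] element i ≃ x) where

    half : ∀ {x y e} → Fix x → Fix y → (∀ {m} → (f^ m) x ≃ x ⇔ e ∣ m) → ∀ i → (f^ i) x ≃ y → e ∣ i + i
    half Fx Fy period-e i p = to period-e (Fix-^⁻¹ Fx i (Fix-resp (≃-sym p) Fy))

    -- If `(f^ i) x` is a fixpoint other than `x`, the period `e` divides `i + i` but not `i`: it
    -- lies half a period away from `x`. There is only one such point.
    at-most-two : ∀ {x y z} → Fix x → Fix y → Fix z → x ≋ y → x ≋ z → ¬ x ≃ y → ¬ x ≃ z → y ≃ z
    at-most-two {x} {y} {z} Fx Fy Fz (i , f^ix≃y) (j , f^jx≃z) x≄y x≄z with period x
    ... | e , _ , period-e = ≃-trans (≃-sym f^ix≃y) (≃-trans f^ix≃f^jx f^jx≃z)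
      where
      e∣2i : e ∣ i + i
      e∣2i = half Fx Fy period-e i f^ix≃y
      e∣2j : e ∣ j + j
      e∣2j = half Fx Fz period-e j f^jx≃z
      e∤_ : ∀ i {y} → (f^ i) x ≃ y → ¬ x ≃ y → ¬ e ∣ i
      (e∤ i) p x≄y e∣i = x≄y (≃-trans (≃-sym (from period-e e∣i)) p)
      e∣j+i : e ∣ j + i
      e∣j+i = half-odd-multiples-add e∣2j ((e∤ j) f^jx≃z x≄z) e∣2i ((e∤ i) f^ix≃y x≄y)
      f^ix≃f^jx : (f^ i) x ≃ (f^ j) x
      f^ix≃f^jx = ^-injective j (≃-trans (≃-sym (^-+ j i x)) (≃-trans (from period-e e∣j+i)
        (≃-trans (≃-sym (from period-e e∣2j)) (^-+ j j x))))

    -- The hypothesis f x ≃₂ x says that the period of x is odd.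
    alone : ∀ {x y} → Fix x → Fix y → x ≋ y → f x ≃₂ x → x ≃ y
    alone {x} {y} Fx Fy (i , f^ix≃y) (j , p) with period x
    ... | e , _ , period-e = ≃-trans (≃-sym (from period-e (∣-half {e} {j} {i} odd-period (half Fx Fy period-e i f^ix≃y)))) f^ix≃y
      where
      odd-period : e ∣ suc (j + j)
      odd-period = to period-e (≃-trans (^-comm 1 (j + j) x) p)

    -- An odd period `1 + 2j` lets the even power `2j` take `f x` back to `x`; for an even period
    -- the point half a period away is the second fixpoint.
    alone⊎pair : ∀ {x} → Fix x → f x ≃₂ x ⊎ (∃[ y ] Fix y × x ≋ y × ¬ x ≃ y)
    alone⊎pair {x} Fx with period x
    ... | e , e≢0 , period-e with even⊎odd e
    ...   | inj₂ (j , refl) = inj₁ (j , ≃-trans (^-comm (j + j) 1 x) (from period-e (divides 1 (sym (ℕ.*-identityˡ _)))))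
    ...   | inj₁ (zero  , refl) = contradiction (>-nonZero⁻¹ 0 {{e≢0}}) λ ()
    ...   | inj₁ (suc j , refl) = inj₂ ((f^ (suc j)) x , Fix-^ Fx (suc j) (from period-e (divides 1 (sym (ℕ.*-identityˡ _)))) ,
              (suc j , ≃-refl) , λ x≃y → >⇒∤ (ℕ.m<m+n (suc j) (s≤s z≤n)) (to period-e (≃-sym x≃y)))

    -- Matching the fixpoints with the orbits of the square.

    Fixpoint : Set _
    Fixpoint = ∃[ x ] Fix x

    abstract
      -- Taking the least number in the enumeration makes the choice depend on the orbit only, as
      -- `rep-cong` records.
      representative-index : ((x , _) : Fixpoint) → ∃[ i ] x ≋ element i × (∀ j → x ≋ element j → i Fin.≤ j)
      representative-index (x , Fx) = least (λ i → x ≋? element i)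
        (proj₁ (number Fx) , 0 , ≃-sym (proj₂ (number Fx)))

    index : Fixpoint → Fin N
    index s = proj₁ (representative-index s)

    representative : Fixpoint → Fixpoint
    representative s = element (index s) , element-Fix (index s)

    rep : Fixpoint → Carrier
    rep s = proj₁ (representative s)

    ≋-rep : ∀ s → proj₁ s ≋ rep s
    ≋-rep s = proj₁ (proj₂ (representative-index s))

    rep-cong : ∀ s t → proj₁ s ≋ proj₁ t → rep s ≃ rep t
    rep-cong s t s≋t = ≃-reflexive (cong element (toℕ-injective (ℕ.≤-antisym
      (first s (index t) (≋-trans s≋t (≋-rep t)))
      (first t (index s) (≋-trans (≋-sym s≋t) (≋-rep s))))))
      where
      first : ∀ s j → proj₁ s ≋ element j → index s Fin.≤ j
      first s = proj₂ (proj₂ (representative-index s))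

    -- An orbit with one fixpoint is a single f²-orbit, one with two fixpoints
    -- x₀ and y splits into the f²-orbits of x₀ and of f x₀.
    data Offset (s : Fixpoint) : ℕ → Set (a ⊔ˡ ℓ) where
      at  : proj₁ s ≃ rep s → Offset s 0
      off : ¬ rep s ≃ proj₁ s → Offset s 1

    abstract
      offset : ∀ s → ∃[ k ] Offset s k
      offset s with proj₁ s ≟ rep s
      ... | yes p = 0 , at p
      ... | no ¬p = 1 , off (¬p ∘ ≃-sym)

    half-orbit : Fixpoint → Carrier
    half-orbit s = (f^ (proj₁ (offset s))) (rep s)

    ≃₂⇒≋ : ∀ {x y} → x ≃₂ y → x ≋ y
    ≃₂⇒≋ (j , p) = j + j , p

    -- With equal offsets, `s` and `t` are both the representative, or both the other fixpoint.
    -- Different offsets would put `rep s` and its image under `f` in one orbit of the square,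
    -- making the representative the only fixpoint, against `off`.
    offset-injective : ∀ {s t k l} → rep s ≃ rep t → proj₁ s ≋ proj₁ t → Offset s k → Offset t l →
                       (f^ k) (rep s) ≃₂ (f^ l) (rep t) → proj₁ s ≃ proj₁ t
    offset-injective r _ (at p)  (at q)  _ = ≃-trans p (≃-trans r (≃-sym q))
    offset-injective {s} {t} r s≋t (off p) (off q) _ = at-most-two (proj₂ (representative s)) (proj₂ s) (proj₂ t)
      (≋-sym (≋-rep s)) (≋-trans (≋-sym (≋-rep s)) s≋t) p (q ∘ ≃-trans (≃-sym r))
    offset-injective {s} {t} r _ (at _)  (off q) e = contradiction
      (alone (proj₂ (representative t)) (proj₂ t) (≋-sym (≋-rep t)) (≃₂-trans (≃₂-sym e) (0 , r))) q
    offset-injective {s} {t} r _ (off p) (at _)  e = contradiction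
      (alone (proj₂ (representative s)) (proj₂ s) (≋-sym (≋-rep s)) (≃₂-trans e (0 , ≃-sym r))) p

    half-orbit-injective : ∀ s t → half-orbit s ≃₂ half-orbit t → proj₁ s ≃ proj₁ t
    half-orbit-injective s t e = offset-injective {s} {t} (rep-cong s t s≋t) s≋t (proj₂ (offset s)) (proj₂ (offset t)) e
      where
      s≋t : proj₁ s ≋ proj₁ t
      s≋t = ≋-trans (≋-trans (≋-rep s) (proj₁ (offset s) , ≃-refl))
        (≋-trans (≃₂⇒≋ e) (≋-sym (≋-trans (≋-rep t) (proj₁ (offset t) , ≃-refl))))

    offset-cong : ∀ {s t k l} → proj₁ s ≃ proj₁ t → rep s ≃ rep t → Offset s k → Offset t l → k ≡ l
    offset-cong s≃t r (at p)  (at q)  = refl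
    offset-cong s≃t r (off p) (off q) = refl
    offset-cong s≃t r (at p)  (off q) = contradiction (≃-trans (≃-sym r) (≃-trans (≃-sym p) s≃t)) q
    offset-cong s≃t r (off p) (at q)  = contradiction (≃-trans r (≃-trans (≃-sym q) (≃-sym s≃t))) p

    half-orbit-offset : ∀ s t {k} → proj₁ s ≃ proj₁ t → Offset t k → half-orbit s ≃ (f^ k) (rep t)
    half-orbit-offset s t s≃t o = ≃-trans (^-cong (proj₁ (offset s)) r)
      (≃-reflexive (cong (fold (rep t) f) (offset-cong {s} {t} s≃t r (proj₂ (offset s)) o)))
      where
      r : rep s ≃ rep t
      r = rep-cong s t (0 , s≃t)

    half-orbit-cong : ∀ s t → proj₁ s ≃ proj₁ t → half-orbit s ≃ half-orbit t
    half-orbit-cong s t s≃t = half-orbit-offset s t s≃t (proj₂ (offset t))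

    -- The parity of an exponent leading from the representative `r` to `x` tells whether `x` is in
    -- the half-orbit of `r` or of `f r`. The first comes from `r`; the second comes from the other
    -- fixpoint or, if there is none, equals the first.
    half-orbit-surjective : ∀ {x} k → Fix ((f^ k) x) → ∃[ s ] half-orbit s ≃₂ x
    half-orbit-surjective {x} k Fix-f^kx with ≋-trans (≋-sym (≋-rep t)) (≋-sym (k , ≃-refl))
      where
      t : Fixpoint
      t = (f^ k) x , Fix-f^kx
    ... | m , f^mr≃x = by-parity (even⊎odd m)
      where
      t r : Fixpoint
      t = (f^ k) x , Fix-f^kx
      r = representative t
      rep-idem : ∀ u → proj₁ r ≋ proj₁ u → rep u ≃ proj₁ r
      rep-idem u p = rep-cong u t (≋-sym (≋-trans (≋-rep t) p))
      r-half : half-orbit r ≃ proj₁ r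
      r-half = ≃-trans (half-orbit-offset r r ≃-refl (at (≃-sym (rep-idem r (0 , ≃-refl))))) (rep-idem r (0 , ≃-refl))
      by-parity : (∃[ i ] m ≡ i + i) ⊎ (∃[ i ] m ≡ suc (i + i)) → ∃[ s ] half-orbit s ≃₂ x
      by-parity (inj₁ (i , refl)) = r , ≃₂-trans (0 , r-half) (i , f^mr≃x)
      by-parity (inj₂ (i , refl)) with alone⊎pair (proj₂ r)
      ... | inj₁ fr≃₂r = r , ≃₂-trans (0 , r-half) (≃₂-trans (≃₂-sym fr≃₂r) (i , ≃-trans (^-comm (i + i) 1 (proj₁ r)) f^mr≃x))
      ... | inj₂ (y , Fy , r≋y , r≄y) = s , ≃₂-trans (0 , s-half) (i , ≃-trans (^-comm (i + i) 1 (proj₁ r)) f^mr≃x)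
        where
        s : Fixpoint
        s = y , Fy
        s-half : half-orbit s ≃ f (proj₁ r)
        s-half = ≃-trans (half-orbit-offset s s ≃-refl (off (r≄y ∘ ≃-trans (≃-sym (rep-idem s r≋y))))) (f-cong (rep-idem s r≋y))

-- _≈_ unfolds to a function type, from which its arguments cannot be inferred.
infix 4 _≅_

record _≅_ {n} (π ρ : Partition n) : Set where
  constructor ⟨_⟩
  field same : π ≈ ρ

open _≅_

≅-setoid : ℕ → Setoid _ _
≅-setoid n = record
  { Carrier       = Partition n
  ; _≈_           = _≅_
  ; isEquivalence = record
    { refl  = λ {π} → ⟨ ≈.refl {x = π} ⟩
    ; sym   = λ {π} {ρ} p → ⟨ ≈.sym {x = π} {ρ} (same p) ⟩
    ; trans = λ {π} {ρ} {σ} p q → ⟨ ≈.trans {i = π} {ρ} {σ} (same p) (same q) ⟩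
    }
  }

module ≅ {n} = Setoid (≅-setoid n)

_≅?_ : ∀ {n} → Decidable₂ (_≅_ {n})
π ≅? ρ = map′ (λ p → ⟨ (λ i j → mk⇔ (proj₁ (p i j)) (proj₂ (p i j))) ⟩) (λ p i j → to (same p i j) , from (same p i j))
  (all? λ i → all? λ j → (Part._~?_ π i j →-dec Part._~?_ ρ i j) ×-dec (Part._~?_ ρ i j →-dec Part._~?_ π i j))

𝐂-cong′ : ∀ {n} {π ρ : Partition n} → π ≅ ρ → 𝐂 π ≅ 𝐂 ρ
𝐂-cong′ {π = π} {ρ} p = ⟨ 𝐂-cong {π = π} {ρ} (same p) ⟩

K-cong : ∀ {n} {π ρ : Partition n} → π ≅ ρ → K π ≅ K ρ
K-cong {π = π} {ρ} p = ⟨ dual-cong (flip lt) {π} {ρ} (same p) ⟩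

K⁺-cong : ∀ {n} {π ρ : Partition n} → π ≅ ρ → K⁺ π ≅ K⁺ ρ
K⁺-cong {π = π} {ρ} p = ⟨ dual-cong lt {π} {ρ} (same p) ⟩

-- Rotation classes as orbits of the square of the Kreweras complement.

module Classes (n : ℕ) .{{_ : NonZero n}} where

  private
    instance
      NonZero-2n : NonZero (n + n)
      NonZero-2n = >-nonZero (ℕ.≤-trans (>-nonZero⁻¹ n) (ℕ.m≤m+n n n))

  K^ K⁺^ : ℕ → Partition n → Partition n
  K^  m π = fold π K m
  K⁺^ m π = fold π K⁺ m

  K⁺-K : {π : Partition n} → NonCrossing π → K⁺ (K π) ≅ π
  K⁺-K {π} nc = ⟨ Hull.K⁺-K {π = π} nc ⟩

  R-cong′ : {π ρ : Partition n} → π ≅ ρ → R π ≅ R ρ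
  R-cong′ {π} {ρ} p = ⟨ R-cong {π = π} {ρ} (same p) ⟩

  R≅K² : {π : Partition n} → NonCrossing π → R π ≅ K (K π)
  R≅K² {π} nc = ≅.trans (R-cong′ {π} {K⁺ (K π)} (≅.sym (K⁺-K {π} nc))) ⟨ R-K⁺ (K π) ⟩

  iterate-R-cong : ∀ m {π ρ : Partition n} → π ≅ ρ → iterate R π m ≅ iterate R ρ m
  iterate-R-cong zero    p = p
  iterate-R-cong (suc m) {π} {ρ} p = iterate-R-cong m {R π} {R ρ} (R-cong′ {π} {ρ} p)

  iterate-R≅K^ : ∀ m {π : Partition n} → NonCrossing π → iterate R π m ≅ K^ (m + m) π
  iterate-R≅K^ zero        nc = ≅.refl
  iterate-R≅K^ (suc m) {π} nc = ≅.trans (iterate-R-cong m {R π} {K (K π)} (R≅K² {π} nc))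
    (≅.trans (iterate-R≅K^ m {K (K π)} (K-nonCrossing (K π)))
      (≅.reflexive (trans (sym (fold-+ π K (m + m) 2)) (cong (λ k → K^ k π) (2+ m)))))
    where
    2+ : ∀ m → m + m + 2 ≡ suc m + suc m
    2+ = solve-∀

  K^2n : {π : Partition n} → NonCrossing π → K^ (n + n) π ≅ π
  K^2n {π} nc = ≅.trans (≅.sym (iterate-R≅K^ n nc)) ⟨ R^n π ⟩

  record NC : Set₁ where
    constructor _,_
    field
      partition   : Partition n
      nonCrossing : NonCrossing partition

  open NC

  record _≃ᴺ_ (x y : NC) : Set where
    constructor ⟨_⟩
    field same : partition x ≅ partition y

  NCs : Setoid _ _
  NCs = record
    { Carrier       = NC
    ; _≈_           = _≃ᴺ_
    ; isEquivalence = record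
      { refl  = ⟨ ≅.refl ⟩
      ; sym   = λ p → ⟨ ≅.sym (_≃ᴺ_.same p) ⟩
      ; trans = λ p q → ⟨ ≅.trans (_≃ᴺ_.same p) (_≃ᴺ_.same q) ⟩
      }
    }

  κ : NC → NC
  κ (π , _) = K π , K-nonCrossing π

  partition-κ^ : ∀ m x → partition (fold x κ m) ≡ K^ m (partition x)
  partition-κ^ zero    x = refl
  partition-κ^ (suc m) x = cong K (partition-κ^ m x)

  κ^2n : ∀ x → fold x κ (n + n) ≃ᴺ x
  κ^2n x = ⟨ ≅.trans (≅.reflexive (partition-κ^ (n + n) x)) (K^2n (nonCrossing x)) ⟩

  open Orbit NCs (λ x y → map′ ⟨_⟩ _≃ᴺ_.same (partition x ≅? partition y)) κ (λ p → ⟨ K-cong (_≃ᴺ_.same p) ⟩) (n + n)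
    κ^2n

  open Setoid NCs using () renaming (_≈_ to _≃_; refl to ≃-refl; sym to ≃-sym; trans to ≃-trans; reflexive to ≃-reflexive)
  open _≃ᴺ_ renaming (same to same′)

  K⁺^-cong : ∀ m {π ρ : Partition n} → π ≅ ρ → K⁺^ m π ≅ K⁺^ m ρ
  K⁺^-cong zero    p = p
  K⁺^-cong (suc m) p = K⁺-cong (K⁺^-cong m p)

  K⁺^-κ^ : ∀ m x → K⁺^ m (partition ((f^ m) x)) ≅ partition x
  K⁺^-κ^ zero    x = ≅.refl
  K⁺^-κ^ (suc m) x = ≅.trans (K⁺-cong (≅.trans (K⁺^-cong m (same′ (^-comm 1 m x))) (K⁺^-κ^ m (κ x))))
    (K⁺-K {partition x} (nonCrossing x))

  𝐂-K^ : ∀ m (π : Partition n) → 𝐂 (K^ m π) ≅ K⁺^ m (𝐂 π)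
  𝐂-K^ zero    π = ≅.refl
  𝐂-K^ (suc m) π = ≅.trans ⟨ 𝐂-K (K^ m π) ⟩ (K⁺-cong (𝐂-K^ m π))

  -- The dihedral relation `C K^m = K^(-m) C` without negative exponents: `z` stands for
  -- `K^(-m) C x`.
  𝐂-κ^ : ∀ m {x z} → 𝐂 (partition x) ≅ partition ((f^ m) z) → 𝐂 (partition ((f^ m) x)) ≅ partition z
  𝐂-κ^ m {x} {z} p = ≅.trans (≅.reflexive (cong 𝐂 (partition-κ^ m x)))
    (≅.trans (𝐂-K^ m (partition x)) (≅.trans (K⁺^-cong m p) (K⁺^-κ^ m z)))

  ∈A⇔ : ∀ y ρ → A (partition y) ρ ⇔ (∃[ j ] partition ((f^ (j + j)) y) ≅ ρ)
  ∈A⇔ y ρ = mk⇔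
    (λ (i , _ , p) → i , ≅.trans (≅.sym (iterate-R≅κ^ i)) ⟨ p ⟩)
    -- Membership in `A` asks for an exponent of at least 1, so a full turn of `n` rotations is
    -- added; `wind` removes it again.
    (λ (j , p) → n + j , ℕ.≤-trans (>-nonZero⁻¹ n) (ℕ.m≤m+n n j) ,
       same (≅.trans (iterate-R≅κ^ (n + j)) (≅.trans (same′ (wind j)) p)))
    where
    iterate-R≅κ^ : ∀ i → iterate R (partition y) i ≅ partition ((f^ (i + i)) y)
    iterate-R≅κ^ i = ≅.trans (iterate-R≅K^ i {partition y} (nonCrossing y)) (≅.reflexive (sym (partition-κ^ (i + i) y)))
    rearrange : ∀ n j → n + j + (n + j) ≡ j + j + 1 * (n + n)
    rearrange = solve-∀
    wind : ∀ j → (f^ (n + j + (n + j))) y ≃ (f^ (j + j)) y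
    wind j = ≃-trans (≃-reflexive (cong (fold y κ) (rearrange n j)))
      (≃-trans (^-+ (j + j) (1 * (n + n)) y) (^-cong (j + j) (^-multiple {n + n} (κ^2n y) 1)))

  A-≐ : ∀ u v → A (partition u) ≐ A (partition v) ⇔ u ≃₂ v
  A-≐ u v = mk⇔
    (λ (_ , ⊇) → let j , p = to (∈A⇔ u (partition v)) (⊇ {partition v} (from (∈A⇔ v (partition v)) (0 , ≅.refl))) in j , ⟨ p ⟩)
    (λ u≃₂v → (λ {ρ} → A-⊆ {v} {u} (≃₂-sym u≃₂v) {ρ}) , (λ {ρ} → A-⊆ {u} {v} u≃₂v {ρ}))
    where
    A-⊆ : ∀ {u v} → u ≃₂ v → ∀ {ρ} → A (partition v) ρ → A (partition u) ρ
    A-⊆ {u} {v} (j , p) {ρ} ρ∈ with to (∈A⇔ v ρ) ρ∈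
    ... | i , q = from (∈A⇔ u ρ) (i + j , ≅.trans
      (same′ (≃-trans (≃-reflexive (cong (fold u κ) (sym (interchange i j))))
        (≃-trans (^-+ (i + i) (j + j) u) (^-cong (i + i) p)))) q)
      where
      interchange : ∀ i j → i + i + (j + j) ≡ i + j + (i + j)
      interchange = solve-∀

  Fixed : NC → Set
  Fixed x = 𝐂 (partition x) ≅ partition x

  fixed-if : ∀ {x} → Fixed x → ∀ i → (f^ (i + i)) x ≃ x → Fixed ((f^ i) x)
  fixed-if {x} Cx≅x i p = 𝐂-κ^ i {x} (≅.trans Cx≅x (same′ (≃-trans (≃-sym p) (^-+ i i x))))

  fixed-only-if : ∀ {x} → Fixed x → ∀ i → Fixed ((f^ i) x) → (f^ (i + i)) x ≃ x
  fixed-only-if {x} Cx≅x i q = ≃-trans (^-+ i i x) (≃-trans (^-cong i ⟨ ≅.trans (≅.sym q) Cf^ix ⟩) (^-undo i x))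
    where
    Cf^ix : 𝐂 (partition ((f^ i) x)) ≅ partition ((f^ (pred (n + n) * i)) x)
    Cf^ix = 𝐂-κ^ i {x} (≅.trans Cx≅x (same′ (≃-sym (^-undo i x))))

  -- `C` sends `K^(2i + m) x` to `K^(-2i - m) x`, an even power away from `K^m x` because `m` and
  -- `-m` have the same parity.
  A-closed : ∀ {x} → Fixed x → ∀ m {ρ} → A (partition ((f^ m) x)) ρ → A (partition ((f^ m) x)) (𝐂 ρ)
  A-closed {x} Cx≅x m {ρ} ρ∈A with to (∈A⇔ ((f^ m) x) ρ) ρ∈A
  ... | i , p = from (∈A⇔ ((f^ m) x) (𝐂 ρ)) (j , ≅.trans (≅.sym (𝐂-κ^ s {x} (≅.trans Cx≅x (same′ (≃-sym wind)))))
                  (𝐂-cong′ (≅.trans (same′ (^-+ (i + i) m x)) p)))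
    where
    s = i + i + m
    -- The exponent must satisfy `2j = - s - m = - 2(m + i)` modulo `2n`, so `j` is `- (m + i)`
    -- modulo `n`.
    j = pred n * (m + i)
    total : s + (j + j + m) ≡ (m + i) * (n + n)
    total = trans (lemma i m (pred n)) (cong (λ n → (m + i) * (n + n)) (ℕ.suc-pred n))
      where
      lemma : ∀ i m k → i + i + m + (k * (m + i) + k * (m + i) + m) ≡ (m + i) * (suc k + suc k)
      lemma = solve-∀
    wind : (f^ s) ((f^ (j + j)) ((f^ m) x)) ≃ x
    wind = ≃-trans (^-cong s (≃-sym (^-+ (j + j) m x))) (≃-trans (≃-sym (^-+ s (j + j + m) x))
      (≃-trans (≃-reflexive (cong (fold x κ) total))
        (^-multiple {n + n} (κ^2n x) (m + i))))

  module _ {N} (index : Inverse (selfComplementaryNCs n) (setoid (Fin N))) where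

    open module I = Inverse index using () renaming (to to number; from to element)

    private
      SC : Set₁
      SC = SelfComplementaryNC n

    underlying : SC → NC
    underlying s = SelfComplementaryNC.partition s , SelfComplementaryNC.nonCrossing s

    fixed : ∀ s → Fixed (underlying s)
    fixed s = ⟨ SelfComplementaryNC.selfComplementary s ⟩

    restore : ∀ {x} → Fixed x → SC
    restore {x} Cx≅x = record { partition = partition x ; nonCrossing = nonCrossing x ; selfComplementary = same Cx≅x }

    open Reflection Fixed (λ p Fx → ≅.trans (𝐂-cong′ (≅.sym (same′ p))) (≅.trans Fx (same′ p)))
      fixed-if fixed-only-if (λ i → underlying (element i)) (λ i → fixed (element i))
      (λ {x} Fx → number (restore {x} Fx) ,
        ⟨ ⟨ I.strictlyInverseʳ (restore {x} Fx) ⟩ ⟩)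

    fixpoint : SC → Fixpoint
    fixpoint s = underlying s , fixed s

    members : SelfComplementaryClass n → Pred (Partition n) _
    members = SelfComplementaryClass.members

    classOf : SC → SelfComplementaryClass n
    classOf s = record
      { members           = A y
      ; isRotationClass   = y , nonCrossing (half-orbit (fixpoint s)) , (λ p → p) , (λ p → p)
      ; selfComplementary =
          (λ { {ρ} (σ , σ∈A , Cσ≈ρ) → A-resp {𝐂 σ} {ρ} ⟨ Cσ≈ρ ⟩ (closed {σ} σ∈A) })
        , (λ {ρ} ρ∈A → 𝐂 ρ , closed {ρ} ρ∈A , 𝐂-involutive ρ)
      }
      where
      y = partition (half-orbit (fixpoint s))
      A-resp : ∀ {σ ρ} → σ ≅ ρ → A y σ → A y ρ
      A-resp {σ} {ρ} p (i , i≥1 , q) = i , i≥1 , ≈.trans {i = iterate R y i} {σ} {ρ} q (same p)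
      closed : ∀ {σ} → A y σ → A y (𝐂 σ)
      closed {σ} = A-closed {rep (fixpoint s)} (proj₂ (representative (fixpoint s))) (proj₁ (offset (fixpoint s))) {σ}

    classOf-≐ : ∀ s y → half-orbit (fixpoint s) ≃₂ y → members (classOf s) ≐ A (partition y)
    classOf-≐ s y = from (A-≐ (half-orbit (fixpoint s)) y)

    classOf-hits : ∀ x y → half-orbit x ≃₂ y → ∃[ s ] members (classOf s) ≐ A (partition y)
    classOf-hits x y e = s , classOf-≐ s y (≃₂-trans (0 , half-orbit-cong (fixpoint s) x ≃-refl) e)
      where
      s : SC
      s = restore {proj₁ x} (proj₂ x)

    𝐂-member : ∀ 𝒜 (p : NC) → members 𝒜 ≐ A (partition p) → A (partition p) (𝐂 (partition p))
    𝐂-member 𝒜 p (⊆A , A⊆) = ⊆A {𝐂 π} (proj₁ (SelfComplementaryClass.selfComplementary 𝒜) {𝐂 π} (π , A⊆ {π} π∈A , Cπ≈Cπ))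
      where
      π = partition p
      π∈A : A π π
      π∈A = from (∈A⇔ p π) (0 , ≅.refl {x = π})
      Cπ≈Cπ : 𝐂 π ≈ 𝐂 π
      Cπ≈Cπ = ≈.refl {x = 𝐂 π}

    member-fixed : ∀ 𝒜 (p : NC) → members 𝒜 ≐ A (partition p) → ∃[ k ] Fixed ((f^ k) p)
    member-fixed 𝒜 p eq with to (∈A⇔ p (𝐂 (partition p))) (𝐂-member 𝒜 p eq)
    ... | k , e = k , 𝐂-κ^ k {p} {(f^ k) p} (≅.trans (≅.sym e) (same′ (^-+ k k p)))

    classOf-reaches : ∀ (p : NC) → ∃[ k ] Fixed ((f^ k) p) → ∃[ s ] members (classOf s) ≐ A (partition p)
    classOf-reaches p (k , Fix-κ^kp) = classOf-hits (proj₁ x) p (proj₂ x)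
      where
      x : ∃[ x ] half-orbit x ≃₂ p
      x = half-orbit-surjective {p} k Fix-κ^kp

    classOf-surjective : ∀ 𝒜 → ∃[ s ] members (classOf s) ≐ members 𝒜
    classOf-surjective 𝒜 = through (proj₁ isRC , proj₁ (proj₂ isRC)) (proj₂ (proj₂ isRC))
      where
      isRC = SelfComplementaryClass.isRotationClass 𝒜
      through : ∀ (p : NC) → members 𝒜 ≐ A (partition p) → ∃[ s ] members (classOf s) ≐ members 𝒜
      through p eq = proj₁ hit , ≐-trans {i = members (classOf (proj₁ hit))} {A (partition p)} {members 𝒜} (proj₂ hit)
        (≐-sym {x = members 𝒜} {A (partition p)} eq)
        where
        hit : ∃[ s ] members (classOf s) ≐ A (partition p)
        hit = classOf-reaches p (member-fixed 𝒜 p eq)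

    fixedPartitions→classes : Bijection (selfComplementaryNCs n) (selfComplementaryClasses n)
    fixedPartitions→classes = record
      { to        = classOf
      ; cong      = λ {s} {t} → classOf-cong {s} {t}
      ; bijective = (λ {s} {t} e → same (same′ (half-orbit-injective (fixpoint s) (fixpoint t) (to (≐⇔ s t) e))))
                  , (λ 𝒜 → let s , e = classOf-surjective 𝒜 in s ,
                      λ {t} t≈s → ≐-trans {i = members (classOf t)} {members (classOf s)} {members 𝒜} (classOf-cong {t} {s} t≈s) e)
      }
      where
      ≐⇔ : ∀ s t → members (classOf s) ≐ members (classOf t) ⇔ half-orbit (fixpoint s) ≃₂ half-orbit (fixpoint t)
      ≐⇔ s t = A-≐ (half-orbit (fixpoint s)) (half-orbit (fixpoint t))
      classOf-cong : ∀ {s t} → SelfComplementaryNC.partition s ≈ SelfComplementaryNC.partition t →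
                     members (classOf s) ≐ members (classOf t)
      classOf-cong {s} {t} p = from (≐⇔ s t) (0 , half-orbit-cong (fixpoint s) (fixpoint t) ⟨ ⟨ p ⟩ ⟩)

theorem2 : ∀ (n : ℕ) .{{_ : NonZero n}} →
    Bijection (selfComplementaryClasses n) (selfComplementaryNCs n) ×
    Bijection (selfComplementaryClasses n) (setoid (Fin (n C ⌊ n /2⌋)))
theorem2 n = classes→fixedPartitions , Composition.bijection classes→fixedPartitions fixedPartitions→Fin
  where
  fixedPartitions→Fin : Bijection (selfComplementaryNCs n) (setoid (Fin (n C ⌊ n /2⌋)))
  fixedPartitions→Fin = subst (λ N → Bijection (selfComplementaryNCs n) (setoid (Fin N))) (#Path-zero n)
    (Inverse⇒Bijection (Composition.inverse (Symmetry.inverse (Bijection⇒Inverse (paths→fixedPartitions n))) (Path↔Fin 0 n)))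

  classes→fixedPartitions : Bijection (selfComplementaryClasses n) (selfComplementaryNCs n)
  classes→fixedPartitions = Inverse⇒Bijection (Symmetry.inverse (Bijection⇒Inverse
    -- The numbering of the self-complementary partitions enters here, to choose a representative in
    -- each `K`-orbit.
    (Classes.fixedPartitions→classes n (Bijection⇒Inverse fixedPartitions→Fin))))
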